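{- Let $A$ be an $n\times n$ real skew-symmetric matrix and let $B$ be an $(n-1)\times(n-1)$ principal submatrix of $A$. Then $\sigma(B)$ interlaces $\sigma(A)$.
   Context: All eigenvalues of a real skew-symmetric matrix lie in $\mathrm{i}\mathbb{R}=\{\mathrm{i}a: a\in\mathbb{R}\}$, where $\mathrm{i}=\sqrt{ -1}$. Order on $\mathrm{i}\mathbb{R}$: for $a,b\in \mathrm{i}\mathbb{R}$, $a\le b$ means $-\mathrm{i}a\le -\mathrm{i}b$ as real numbers. $\sigma(\cdot)$ denotes the spectrum, i.e. the eigenvalues listed with multiplicity, presented in increasing order with respect to this order. If $\mathcal{A}=\{\lambda_1,\ldots,\lambda_n\}$ and $\mathcal{B}=\{\mu_1,\ldots,\mu_{n-1}\}$ are contained in $\mathrm{i}\mathbb{R}$ and presented in increasing order, then $\mathcal{B}$ interlaces $\mathcal{A}$ if $\lambda_1\le\mu_1\le\lambda_2\le\cdots\le\mu_{n-1}\le\lambda_n$. -}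

module Defs where

open import Level using (0ℓ)
open import Algebra.Bundles.Raw using (RawRing)
import Algebra.Definitions.RawSemiring as RawSemiringDefinitions
open import Data.Fin.Base as Fin using (Fin; zero; suc; toℕ; inject₁; punchIn)
open import Data.Nat.Base as ℕ using (ℕ; zero; suc; _⊔_)
import Data.Nat.Properties as ℕ
open import Data.Product.Base using (∃-syntax; _×_; _,_)
open import Data.Rational.Base
  using (ℚ; 0ℚ; 1ℚ; ½; ∣_∣; _+_; _*_; _-_; -_; 1/_; _≤_; _<_; Positive; NonNegative; NonZero; positive)
import Data.Rational.Properties as ℚ
open import Data.Rational.Solver using (module +-*-Solver)
open import Data.Vec.Functional using (Vector)
open import Relation.Binary.PropositionalEquality
  using (_≡_; refl; sym; trans; cong; subst; module ≡-Reasoning)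

open +-*-Solver using (solve; _:=_; _:+_; _:*_; :-_; _:-_)

------------------------------------------------------------------------
-- Real numbers: Cauchy sequences of rationals, with an equivalence
-- relation _≈ℝ_ in place of a quotient.

IsCauchy : (ℕ → ℚ) → Set
IsCauchy x = ∀ ε → 0ℚ < ε →
  ∃[ N ] (∀ m n → N ℕ.≤ m → N ℕ.≤ n → ∣ x m - x n ∣ < ε)

record ℝ : Set where
  constructor mkℝ
  field
    seq    : ℕ → ℚ
    cauchy : IsCauchy seq

open ℝ

infix 4 _≈ℝ_ _≤ℝ_

_≈ℝ_ : ℝ → ℝ → Set
x ≈ℝ y = ∀ ε → 0ℚ < ε → ∃[ N ] (∀ n → N ℕ.≤ n → ∣ seq x n - seq y n ∣ < ε)

-- The slack ε is needed: x ≤ y as reals does not imply that the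
-- representing sequences are eventually ordered termwise.
_≤ℝ_ : ℝ → ℝ → Set
x ≤ℝ y = ∀ ε → 0ℚ < ε → ∃[ N ] (∀ n → N ℕ.≤ n → seq x n < seq y n + ε)

private abstract

  half-pos : ∀ {ε} → 0ℚ < ε → 0ℚ < ½ * ε
  half-pos {ε} 0<ε =
    ℚ.positive⁻¹ (½ * ε) {{ℚ.pos*pos⇒pos ½ ε {{positive 0<ε}}}}

  half+half : ∀ ε → ½ * ε + ½ * ε ≡ ε
  half+half ε = trans (sym (ℚ.*-distribʳ-+ ε ½ ½)) (ℚ.*-identityˡ ε)

  const-cauchy : ∀ q → IsCauchy (λ _ → q)
  const-cauchy q ε 0<ε =
    0 , λ _ _ _ _ → subst (λ t → ∣ t ∣ < ε) (sym (ℚ.+-inverseʳ q)) 0<ε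

  neg-cauchy : ∀ {x} → IsCauchy x → IsCauchy (λ n → - x n)
  neg-cauchy {x} cx ε 0<ε with N , h ← cx ε 0<ε =
    N , λ m n N≤m N≤n → subst (_< ε) (eq (x m) (x n)) (h m n N≤m N≤n)
    where
    eq : ∀ a b → ∣ a - b ∣ ≡ ∣ - a - - b ∣
    eq a b = trans (sym (ℚ.∣-p∣≡∣p∣ (a - b)))
      (cong ∣_∣ (solve 2 (λ a b → :- (a :- b) := :- a :- :- b) refl a b))

  +-cauchy : ∀ {x y} → IsCauchy x → IsCauchy y → IsCauchy (λ n → x n + y n)
  +-cauchy {x} {y} cx cy ε 0<ε
    with N , hx ← cx (½ * ε) (half-pos 0<ε)
       | M , hy ← cy (½ * ε) (half-pos 0<ε) =
    N ⊔ M , λ m n p q → begin-strict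
      ∣ (x m + y m) - (x n + y n) ∣
        ≡⟨ cong ∣_∣ (solve 4 (λ a b c d →
             (a :+ b) :- (c :+ d) := (a :- c) :+ (b :- d)) refl
             (x m) (y m) (x n) (y n)) ⟩
      ∣ (x m - x n) + (y m - y n) ∣
        ≤⟨ ℚ.∣p+q∣≤∣p∣+∣q∣ (x m - x n) (y m - y n) ⟩
      ∣ x m - x n ∣ + ∣ y m - y n ∣
        <⟨ ℚ.+-mono-< (hx m n (ℕ.m⊔n≤o⇒m≤o N M p) (ℕ.m⊔n≤o⇒m≤o N M q))
                      (hy m n (ℕ.m⊔n≤o⇒n≤o N M p) (ℕ.m⊔n≤o⇒n≤o N M q)) ⟩
      ½ * ε + ½ * ε
        ≡⟨ half+half ε ⟩
      ε ∎
    where open ℚ.≤-Reasoning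

  eventually-bounded : ∀ {x} → IsCauchy x →
    ∃[ K ] ∃[ N ] (∀ n → N ℕ.≤ n → ∣ x n ∣ < K)
  eventually-bounded {x} cx with N , h ← cx 1ℚ (ℚ.positive⁻¹ 1ℚ) =
    1ℚ + ∣ x N ∣ , N , λ n N≤n → begin-strict
      ∣ x n ∣
        ≡⟨ cong ∣_∣ (solve 2 (λ a b → a := (a :- b) :+ b) refl (x n) (x N)) ⟩
      ∣ (x n - x N) + x N ∣
        ≤⟨ ℚ.∣p+q∣≤∣p∣+∣q∣ (x n - x N) (x N) ⟩
      ∣ x n - x N ∣ + ∣ x N ∣
        <⟨ ℚ.+-monoˡ-< ∣ x N ∣ (h n N N≤n ℕ.≤-refl) ⟩
      1ℚ + ∣ x N ∣ ∎
    where open ℚ.≤-Reasoning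

  ∣*∣-bound : ∀ {a b K δ} → ∣ a ∣ < K → ∣ b ∣ < δ → ∣ a * b ∣ ≤ K * δ
  ∣*∣-bound {a} {b} {K} {δ} a<K b<δ = begin
    ∣ a * b ∣       ≡⟨ ℚ.∣p*q∣≡∣p∣*∣q∣ a b ⟩
    ∣ a ∣ * ∣ b ∣   ≤⟨ ℚ.*-monoʳ-≤-nonNeg ∣ b ∣ {{ℚ.∣-∣-nonNeg b}} (ℚ.<⇒≤ a<K) ⟩
    K * ∣ b ∣       ≤⟨ ℚ.*-monoˡ-≤-nonNeg K {{K≥0}} (ℚ.<⇒≤ b<δ) ⟩
    K * δ           ∎
    where
    open ℚ.≤-Reasoning
    K≥0 : NonNegative K
    K≥0 = ℚ.pos⇒nonNeg K {{positive (ℚ.≤-<-trans (ℚ.0≤∣p∣ a) a<K)}}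

  -- Every ε > 0 is of the form B * δ with δ > 0.
  divide : ∀ B ε → 0ℚ < B → 0ℚ < ε → ∃[ δ ] (0ℚ < δ × B * δ ≡ ε)
  divide B ε 0<B 0<ε = ε * i , ε*i>0 , eq
    where
    open ≡-Reasoning

    B>0 : Positive B
    B>0 = positive 0<B

    B≢0 : NonZero B
    B≢0 = ℚ.pos⇒nonZero B {{B>0}}

    i : ℚ
    i = (1/ B) {{B≢0}}

    ε*i>0 : 0ℚ < ε * i
    ε*i>0 = ℚ.positive⁻¹ (ε * i)
      {{ℚ.pos*pos⇒pos ε {{positive 0<ε}} i {{ℚ.1/pos⇒pos B {{B>0}}}}}}

    eq : B * (ε * i) ≡ ε
    eq = begin
      B * (ε * i)  ≡⟨ ℚ.*-comm B (ε * i) ⟩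
      ε * i * B    ≡⟨ ℚ.*-assoc ε i B ⟩
      ε * (i * B)  ≡⟨ cong (ε *_) (ℚ.*-inverseˡ B {{B≢0}}) ⟩
      ε * 1ℚ       ≡⟨ ℚ.*-identityʳ ε ⟩
      ε            ∎

  ∣*-*∣-bound : ∀ {K L δ} a b c d → ∣ a ∣ < K → ∣ d ∣ < L →
    ∣ b - d ∣ < δ → ∣ a - c ∣ < δ → ∣ a * b - c * d ∣ ≤ (K + L) * δ
  ∣*-*∣-bound {K} {L} {δ} a b c d a<K d<L b-d a-c = begin
    ∣ a * b - c * d ∣
      ≡⟨ cong ∣_∣ (solve 4 (λ a b c d →
           a :* b :- c :* d := a :* (b :- d) :+ d :* (a :- c)) refl a b c d) ⟩
    ∣ a * (b - d) + d * (a - c) ∣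
      ≤⟨ ℚ.∣p+q∣≤∣p∣+∣q∣ (a * (b - d)) (d * (a - c)) ⟩
    ∣ a * (b - d) ∣ + ∣ d * (a - c) ∣
      ≤⟨ ℚ.+-mono-≤ (∣*∣-bound {a} {b - d} a<K b-d)
                    (∣*∣-bound {d} {a - c} d<L a-c) ⟩
    K * δ + L * δ
      ≡⟨ ℚ.*-distribʳ-+ δ K L ⟨
    (K + L) * δ ∎
    where open ℚ.≤-Reasoning

  half<self : ∀ {ε} → 0ℚ < ε → ½ * ε < ε
  half<self {ε} 0<ε = begin-strict
    ½ * ε           ≡⟨ ℚ.+-identityˡ (½ * ε) ⟨
    0ℚ + ½ * ε      <⟨ ℚ.+-monoˡ-< (½ * ε) (half-pos 0<ε) ⟩
    ½ * ε + ½ * ε   ≡⟨ half+half ε ⟩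
    ε               ∎
    where open ℚ.≤-Reasoning

  *-cauchy : ∀ {x y} → IsCauchy x → IsCauchy y → IsCauchy (λ n → x n * y n)
  *-cauchy {x} {y} cx cy ε 0<ε = step₁ (eventually-bounded cx) (eventually-bounded cy)
    where
    Goal : Set
    Goal = ∃[ N ] (∀ m n → N ℕ.≤ m → N ℕ.≤ n → ∣ x m * y m - x n * y n ∣ < ε)

    Bound : (ℕ → ℚ) → ℚ → ℕ → Set
    Bound z K N = ∀ n → N ℕ.≤ n → ∣ z n ∣ < K

    step₂ : ∀ {K L Nˣ Nʸ} → Bound x K Nˣ → Bound y L Nʸ →
      ∃[ δ ] (0ℚ < δ × (K + L) * δ ≡ ½ * ε) → Goal
    step₂ {Nˣ = Nˣ} {Nʸ} bx by (δ , 0<δ , eq)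
      with M , hx ← cx δ 0<δ | M′ , hy ← cy δ 0<δ =
      (Nˣ ⊔ Nʸ) ⊔ (M ⊔ M′) , λ m n p q →
        let p₁ = ℕ.m⊔n≤o⇒m≤o (Nˣ ⊔ Nʸ) (M ⊔ M′) p
            p₂ = ℕ.m⊔n≤o⇒n≤o (Nˣ ⊔ Nʸ) (M ⊔ M′) p
            q₁ = ℕ.m⊔n≤o⇒m≤o (Nˣ ⊔ Nʸ) (M ⊔ M′) q
            q₂ = ℕ.m⊔n≤o⇒n≤o (Nˣ ⊔ Nʸ) (M ⊔ M′) q
        in ℚ.≤-<-trans
             (∣*-*∣-bound (x m) (y m) (x n) (y n)
               (bx m (ℕ.m⊔n≤o⇒m≤o Nˣ Nʸ p₁))
               (by n (ℕ.m⊔n≤o⇒n≤o Nˣ Nʸ q₁))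
               (hy m n (ℕ.m⊔n≤o⇒n≤o M M′ p₂) (ℕ.m⊔n≤o⇒n≤o M M′ q₂))
               (hx m n (ℕ.m⊔n≤o⇒m≤o M M′ p₂) (ℕ.m⊔n≤o⇒m≤o M M′ q₂)))
             (subst (_< ε) (sym eq) (half<self 0<ε))

    step₁ : ∃[ K ] ∃[ N ] Bound x K N → ∃[ L ] ∃[ N ] Bound y L N → Goal
    step₁ (K , Nˣ , bx) (L , Nʸ , by) = step₂ bx by
      (divide (K + L) (½ * ε) (ℚ.+-mono-< 0<K 0<L) (half-pos 0<ε))
      where
      0<K : 0ℚ < K
      0<K = ℚ.≤-<-trans (ℚ.0≤∣p∣ (x Nˣ)) (bx Nˣ ℕ.≤-refl)
      0<L : 0ℚ < L
      0<L = ℚ.≤-<-trans (ℚ.0≤∣p∣ (y Nʸ)) (by Nʸ ℕ.≤-refl)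

infixl 6 _+ℝ_
infixl 7 _*ℝ_
infix  8 -ℝ_

fromℚ : ℚ → ℝ
fromℚ q = mkℝ (λ _ → q) (const-cauchy q)

0ℝ 1ℝ : ℝ
0ℝ = fromℚ 0ℚ
1ℝ = fromℚ 1ℚ

_+ℝ_ _*ℝ_ : ℝ → ℝ → ℝ
x +ℝ y = mkℝ (λ n → seq x n + seq y n) (+-cauchy {seq x} {seq y} (cauchy x) (cauchy y))
x *ℝ y = mkℝ (λ n → seq x n * seq y n) (*-cauchy {seq x} {seq y} (cauchy x) (cauchy y))

-ℝ_ : ℝ → ℝ
-ℝ x = mkℝ (λ n → - seq x n) (neg-cauchy {seq x} (cauchy x))

------------------------------------------------------------------------
-- Complex numbers

infix 4 _≈ℂ_
infixl 6 _+ℂ_ _-ℂ_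
infixl 7 _*ℂ_
infix  8 -ℂ_

record ℂ : Set where
  constructor _+i_
  field
    re im : ℝ

open ℂ

record _≈ℂ_ (z w : ℂ) : Set where
  constructor _,_
  field
    re-≈ : re z ≈ℝ re w
    im-≈ : im z ≈ℝ im w

fromℝ : ℝ → ℂ
fromℝ x = x +i 0ℝ

0ℂ 1ℂ 𝕚 : ℂ
0ℂ = fromℝ 0ℝ
1ℂ = fromℝ 1ℝ
𝕚  = 0ℝ +i 1ℝ

_+ℂ_ _*ℂ_ : ℂ → ℂ → ℂ
z +ℂ w = (re z +ℝ re w) +i (im z +ℝ im w)
z *ℂ w = (re z *ℝ re w +ℝ -ℝ (im z *ℝ im w)) +i (re z *ℝ im w +ℝ im z *ℝ re w)

-ℂ_ : ℂ → ℂ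
-ℂ z = (-ℝ re z) +i (-ℝ im z)

_-ℂ_ : ℂ → ℂ → ℂ
z -ℂ w = z +ℂ -ℂ w

ℂ-rawRing : RawRing 0ℓ 0ℓ
ℂ-rawRing = record
  { Carrier = ℂ ; _≈_ = _≈ℂ_ ; _+_ = _+ℂ_ ; _*_ = _*ℂ_
  ; -_ = -ℂ_ ; 0# = 0ℂ ; 1# = 1ℂ }

open RawSemiringDefinitions (RawRing.rawSemiring ℂ-rawRing)
  using (sum; product; _^_)

------------------------------------------------------------------------
-- The imaginary axis and its order

_∈iℝ : ℂ → Set
z ∈iℝ = ∃[ a ] (z ≈ℂ 𝕚 *ℂ fromℝ a)

-- For z ∈ iℝ the number - i z is real, i.e. equal to its real part.
-- Outside iℝ this relation compares imaginary parts only; it is used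
-- for spectra, whose elements lie in iℝ.
infix 4 _≤ⁱ_
_≤ⁱ_ : ℂ → ℂ → Set
z ≤ⁱ w = re (-ℂ 𝕚 *ℂ z) ≤ℝ re (-ℂ 𝕚 *ℂ w)

Increasing : ∀ {n} → Vector ℂ n → Set
Increasing zs = ∀ {i j} → i Fin.≤ j → zs i ≤ⁱ zs j

------------------------------------------------------------------------
-- Matrices

Matrix : Set → ℕ → Set
Matrix X n = Fin n → Fin n → X

SkewSymmetric : ∀ {n} → Matrix ℝ n → Set
SkewSymmetric A = ∀ i j → A i j ≈ℝ -ℝ A j i

deleteRowCol : ∀ {X n} → Fin (suc n) → Fin (suc n) → Matrix X (suc n) → Matrix X n
deleteRowCol k l M i j = M (punchIn k i) (punchIn l j)

principalSubmatrix : ∀ {X n} → Fin (suc n) → Matrix X (suc n) → Matrix X n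
principalSubmatrix k = deleteRowCol k k

-- Laplace expansion along the first row.
det : ∀ {n} → Matrix ℂ n → ℂ
det {zero}  M = 1ℂ
det {suc n} M = sum λ j → (-ℂ 1ℂ) ^ toℕ j *ℂ M zero j *ℂ det (deleteRowCol zero j M)

identity : ∀ {n} → Matrix ℂ n
identity zero    zero    = 1ℂ
identity zero    (suc _) = 0ℂ
identity (suc _) zero    = 0ℂ
identity (suc i) (suc j) = identity i j

-- det (z I - A), the characteristic polynomial as a function of z ∈ ℂ.
charPoly : ∀ {n} → Matrix ℝ n → ℂ → ℂ
charPoly A z = det λ i j → z *ℂ identity i j -ℂ fromℝ (A i j)

------------------------------------------------------------------------
-- Spectra and interlacing

-- λs is σ(A): all eigenvalues of A, each repeated according to its
-- multiplicity as a root of the characteristic polynomial, in increasing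
-- order.  The product formula says exactly this, since a polynomial over
-- the infinite field ℂ is determined by its values.  That the
-- eigenvalues lie in iℝ is not assumed.
record IsSpectrum {n} (A : Matrix ℝ n) (λs : Vector ℂ n) : Set where
  field
    eigenvalues : ∀ z → charPoly A z ≈ℂ product (λ j → z -ℂ λs j)
    increasing  : Increasing λs

record Interlaces {n} (μs : Vector ℂ n) (λs : Vector ℂ (suc n)) : Set where
  field
    μs⊆iℝ         : ∀ i → μs i ∈iℝ
    λs⊆iℝ         : ∀ i → λs i ∈iℝ
    μs-increasing : Increasing μs
    λs-increasing : Increasing λs
    lower         : ∀ i → λs (inject₁ i) ≤ⁱ μs i
    upper         : ∀ i → μs i ≤ⁱ λs (suc i)

{-# OPTIONS --safe #-}

-- Let p and q be the characteristic polynomials of A and B, and let y be the column of the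
-- adjugate of z I - A belonging to the deleted index, so that (z I - A) y = p e_k and y_k = q
-- up to a common sign.  As A is real and skew-symmetric, the real part of y* (z I - A) y is
-- Re z |y|², whence Re (p q̄) = Re z |y|² ≥ Re z |q|².  By induction on the size, p has no zeros
-- off the imaginary axis.  Common zeros of p and q may be cancelled without affecting the
-- inequality; when none are left, dividing by s at z = i a_j + s and letting s → 0⁺ gives
--   ∏_{l ≠ j} (a_j - a_l) ∏_l (a_j - b_l) ≥ ∏_l (a_j - b_l)² > 0
-- for the zeros i a_j of p and i b_l of q.  Comparing the signs for consecutive a_j shows that
-- each of the m gaps (a_i , a_{i+1}) contains one of the m numbers b_l, hence exactly one.
--
-- The conclusions are equations and inequalities ≤ between reals, hence negative statements,
-- so the signs of finitely many reals may be decided under ¬¬.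

module Submission where

open import Algebra.Bundles using (CommutativeRing)
import Algebra.Properties.CommutativeMonoid.Sum as MonoidSum
import Algebra.Properties.Ring as RingProperties
import Algebra.Properties.Semiring.Exp as Exp
import Algebra.Properties.Semiring.Mult.TCOptimised as Mult
import Algebra.Properties.Semiring.Sum as SemiringSum
import Algebra.Solver.Ring
open import Algebra.Solver.Ring.AlmostCommutativeRing using (_-Raw-AlmostCommutative⟶_; fromCommutativeRing)
open import Algebra.Structures using (IsCommutativeRing)
open import Data.Fin.Base as Fin using (Fin; zero; suc; toℕ; inject₁; punchIn)
open import Data.Fin.Induction using (<-weakInduction; >-weakInduction)
import Data.Fin.Properties as Fin
open import Data.Integer.Base as ℤ using (ℤ; +_; -[1+_])
import Data.Integer.Properties as ℤ
import Data.Maybe.Base as Maybe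
open import Data.Nat.Base as ℕ using (ℕ; zero; suc)
import Data.Nat.Properties as ℕ
open import Data.Product.Base using (∃-syntax; _×_; _,_; proj₁; proj₂)
open import Data.Rational.Base as ℚ using (ℚ; 0ℚ; 1ℚ; ½; ∣_∣)
import Data.Rational.Properties as ℚ
import Data.Rational.Solver as ℚ
open import Data.Sign.Base as Sign using (Sign)
open import Data.Sum.Base using (_⊎_; inj₁; inj₂)
open import Data.Vec.Functional using (Vector)
open import Defs using (Matrix; deleteRowCol; principalSubmatrix)
open import Effect.Monad using (RawMonad)
open import Function.Base using (_∘_)
open import Level using (0ℓ)
open import Relation.Binary.PropositionalEquality as ≡ using (_≡_; _≢_)
import Relation.Binary.Reasoning.Setoid as SetoidReasoning
open import Relation.Nullary using (¬_; Dec; contradiction; yes; no; dec⇒maybe)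
open import Relation.Nullary.Decidable using (¬¬-excluded-middle)
open import Relation.Nullary.Negation using (¬¬-Monad)

-- The cancellation of common zeros cannot be an induction over matrices: nothing exhibits the two
-- quotients as characteristic polynomials of a skew-symmetric matrix and of a principal submatrix.
-- What the induction carries is the inequality Re z |q|² ≤ Re (p q̄) for Re z > 0, a statement
-- about two lists of zeros. A common factor c multiplies both of its sides by |c|², which is why it
-- drops out. The inequality stays in this cleared form because the ordered ring is axiomatised
-- without division, and the limit s → 0⁺ is replaced by an explicit first-order estimate. The
-- axioms keep the algebra away from Cauchy sequences: their equality unfolds to a quantified
-- statement from which the two sides are hard to infer.

-- Deleting two indices in either order

punchIn-comm : ∀ {n} {j k : Fin (suc n)} → j Fin.≤ k → ∀ c →
  punchIn (inject₁ j) (punchIn k c) ≡ punchIn (suc k) (punchIn j c)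
punchIn-comm {j = zero}              j≤k         c       = ≡.refl
punchIn-comm {j = suc j} {k = suc k} (ℕ.s≤s j≤k) zero    = ≡.refl
punchIn-comm {j = suc j} {k = suc k} (ℕ.s≤s j≤k) (suc c) = ≡.cong suc (punchIn-comm j≤k c)

-- With `punchIn-suc`: for `j ≤ k` the pairs of distinct indices coded by `(inject₁ j , k)` and by
-- `(suc k , j)` are one pair in its two orders. `punchIn-comm` says that the remaining indices are
-- then enumerated alike.
punchIn-inject₁ : ∀ {n} {j k : Fin n} → j Fin.≤ k → punchIn (inject₁ j) k ≡ suc k
punchIn-inject₁ {j = zero}              j≤k         = ≡.refl
punchIn-inject₁ {j = suc j} {k = suc k} (ℕ.s≤s j≤k) = ≡.cong suc (punchIn-inject₁ j≤k)

punchIn-suc : ∀ {n} {j k : Fin n} → j Fin.≤ k → punchIn (suc k) j ≡ inject₁ j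
punchIn-suc {j = zero}              j≤k         = ≡.refl
punchIn-suc {j = suc j} {k = suc k} (ℕ.s≤s j≤k) = ≡.cong suc (punchIn-suc j≤k)

-- A ring solver for an arbitrary commutative ring

module IntegerCoefficients {c ℓ} (R : CommutativeRing c ℓ) where
  open CommutativeRing R hiding (zero)
  open RingProperties ring
  open Mult semiring renaming (_×_ to _×ᵣ_)
  open SetoidReasoning setoid

  -- Normalisation has to compare coefficients, and equality in the ring is undecidable; hence
  -- integers, mapped in canonically. With the optimised multiple `⟦ + 1 ⟧ℤ` computes to `1#`, so
  -- `con (+ 1)` matches a literal `1#` in a goal.
  ⟦_⟧ℤ : ℤ → Carrier
  ⟦ + n ⟧ℤ      = n ×ᵣ 1#
  ⟦ -[1+ n ] ⟧ℤ = - (suc n ×ᵣ 1#)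

  ⊖-homo : ∀ m n → ⟦ m ℤ.⊖ n ⟧ℤ ≈ m ×ᵣ 1# - n ×ᵣ 1#
  ⊖-homo m zero = begin
    m ×ᵣ 1#         ≈⟨ +-identityʳ _ ⟨
    m ×ᵣ 1# + 0#    ≈⟨ +-congˡ -0#≈0# ⟨
    m ×ᵣ 1# - 0#    ∎
  ⊖-homo zero (suc n) = sym (+-identityˡ _)
  ⊖-homo (suc m) (suc n) = begin
    ⟦ suc m ℤ.⊖ suc n ⟧ℤ              ≡⟨ ≡.cong ⟦_⟧ℤ (ℤ.[1+m]⊖[1+n]≡m⊖n m n) ⟩
    ⟦ m ℤ.⊖ n ⟧ℤ                      ≈⟨ ⊖-homo m n ⟩
    m ×ᵣ 1# - n ×ᵣ 1#                 ≈⟨ +-congʳ (+-identityʳ _) ⟨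
    m ×ᵣ 1# + 0# - n ×ᵣ 1#            ≈⟨ +-congʳ (+-congˡ (-‿inverseʳ 1#)) ⟨
    m ×ᵣ 1# + (1# - 1#) - n ×ᵣ 1#     ≈⟨ +-congʳ (+-assoc _ _ _) ⟨
    m ×ᵣ 1# + 1# - 1# - n ×ᵣ 1#       ≈⟨ +-assoc _ _ _ ⟩
    m ×ᵣ 1# + 1# + (- 1# - n ×ᵣ 1#)   ≈⟨ +-cong (+-comm _ _) (-‿+-comm _ _) ⟩
    1# + m ×ᵣ 1# - (1# + n ×ᵣ 1#)     ≈⟨ +-cong (1+× m 1#) (-‿cong (1+× n 1#)) ⟨
    suc m ×ᵣ 1# - suc n ×ᵣ 1#         ∎

  +-homo : ∀ i j → ⟦ i ℤ.+ j ⟧ℤ ≈ ⟦ i ⟧ℤ + ⟦ j ⟧ℤ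
  +-homo (+ m) (+ n)           = ×-homo-+ 1# m n
  +-homo (+ m) -[1+ n ]        = ⊖-homo m (suc n)
  +-homo -[1+ m ] (+ n)        = trans (⊖-homo n (suc m)) (+-comm _ _)
  +-homo -[1+ m ] -[1+ n ]     = begin
    - (suc (suc (m ℕ.+ n)) ×ᵣ 1#)        ≡⟨ ≡.cong (λ k → - (k ×ᵣ 1#)) (ℕ.+-suc (suc m) n) ⟨
    - ((suc m ℕ.+ suc n) ×ᵣ 1#)          ≈⟨ -‿cong (×-homo-+ 1# (suc m) (suc n)) ⟩
    - (suc m ×ᵣ 1# + suc n ×ᵣ 1#)        ≈⟨ -‿+-comm _ _ ⟨
    - (suc m ×ᵣ 1#) - suc n ×ᵣ 1#        ∎

  -homo : ∀ i → ⟦ ℤ.- i ⟧ℤ ≈ - ⟦ i ⟧ℤ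
  -homo (+ zero)  = sym -0#≈0#
  -homo (+ suc n) = refl
  -homo -[1+ n ]  = sym (-‿involutive _)

  ◃-homo⁻ : ∀ n → ⟦ Sign.- ℤ.◃ n ⟧ℤ ≈ - (n ×ᵣ 1#)
  ◃-homo⁻ zero    = sym -0#≈0#
  ◃-homo⁻ (suc n) = refl

  ◃-homo⁺ : ∀ n → ⟦ Sign.+ ℤ.◃ n ⟧ℤ ≈ n ×ᵣ 1#
  ◃-homo⁺ n = reflexive (≡.cong ⟦_⟧ℤ (ℤ.+◃n≡+n n))

  *-homo : ∀ i j → ⟦ i ℤ.* j ⟧ℤ ≈ ⟦ i ⟧ℤ * ⟦ j ⟧ℤ
  *-homo (+ m) (+ n)       = trans (◃-homo⁺ (m ℕ.* n)) (×1-homo-* m n)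
  *-homo (+ m) -[1+ n ]    = trans (◃-homo⁻ (m ℕ.* suc n))
    (trans (-‿cong (×1-homo-* m (suc n))) (-‿distribʳ-* _ _))
  *-homo -[1+ m ] (+ n)    = trans (◃-homo⁻ (suc m ℕ.* n))
    (trans (-‿cong (×1-homo-* (suc m) n)) (-‿distribˡ-* _ _))
  *-homo -[1+ m ] -[1+ n ] = begin
    (suc m ℕ.* suc n) ×ᵣ 1#                ≈⟨ ×1-homo-* (suc m) (suc n) ⟩
    (suc m ×ᵣ 1#) * (suc n ×ᵣ 1#)          ≈⟨ -‿involutive _ ⟨
    - - ((suc m ×ᵣ 1#) * (suc n ×ᵣ 1#))    ≈⟨ -‿cong (-‿distribʳ-* _ _) ⟩
    - ((suc m ×ᵣ 1#) * - (suc n ×ᵣ 1#))    ≈⟨ -‿distribˡ-* _ _ ⟩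
    - (suc m ×ᵣ 1#) * - (suc n ×ᵣ 1#)      ∎

  morphism : ℤ.+-*-rawRing -Raw-AlmostCommutative⟶ fromCommutativeRing R
  morphism = record
    { ⟦_⟧ = ⟦_⟧ℤ ; +-homo = +-homo ; *-homo = *-homo ; -‿homo = -homo
    ; 0-homo = refl ; 1-homo = refl }

  open Algebra.Solver.Ring ℤ.+-*-rawRing (fromCommutativeRing R) morphism
    (λ i j → Maybe.map (reflexive ∘ ≡.cong ⟦_⟧ℤ) (dec⇒maybe (i ℤ.≟ j))) public
    using (solve; con; _:=_; _:+_; _:*_; _:-_; :-_)

-- Laplace expansion along an arbitrary row

module Determinants {ℓ} (R : CommutativeRing 0ℓ ℓ) where
  open CommutativeRing R hiding (zero)
  open RingProperties ring
  open Exp semiring using (_^_)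
  open SemiringSum semiring
  open SetoidReasoning setoid
  open IntegerCoefficients R

  sign : ∀ {n} → Fin n → Carrier
  sign j = (- 1#) ^ toℕ j

  sum-zero : ∀ {n} {v : Vector Carrier n} → (∀ j → v j ≈ 0#) → sum v ≈ 0#
  sum-zero {n} v≈0 = trans (sum-cong-≋ v≈0) (sum-replicate-zero n)

  sign*sign : ∀ {n} (j : Fin n) → sign j * sign j ≈ 1#
  sign*sign zero    = *-identityʳ 1#
  sign*sign (suc j) = trans
    (solve 1 (λ s → :- con (+ 1) :* s :* (:- con (+ 1) :* s) := s :* s) refl (sign j))
    (sign*sign j)

  -- The pairs (j , punchIn j k) are the pairs of distinct indices; exchanging
  -- the components of such a pair changes the parity of j + k.
  alternating-sum : ∀ {n} (f : Fin (suc n) → Fin n → Carrier) →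
    (∀ {j k} → j Fin.≤ k → f (inject₁ j) k ≈ f (suc k) j) →
    sum (λ j → sum (λ k → sign j * (sign k * f j k))) ≈ 0#
  alternating-sum {zero}  f f-sym = +-identityʳ 0#
  alternating-sum {suc n} f f-sym = begin
    sum (λ k → t zero k) + sum (λ j → t (suc j) zero + sum (λ k → t (suc j) (suc k)))
      ≈⟨ +-congˡ (∑-distrib-+ (λ j → t (suc j) zero) (λ j → sum (λ k → t (suc j) (suc k)))) ⟩
    sum (λ k → t zero k) + (sum (λ j → t (suc j) zero) + sum (λ j → sum (λ k → t (suc j) (suc k))))
      ≈⟨ +-assoc _ _ _ ⟨
    sum (λ k → t zero k) + sum (λ j → t (suc j) zero) + sum (λ j → sum (λ k → t (suc j) (suc k)))
      ≈⟨ +-cong (trans (sym (∑-distrib-+ (t zero) (λ j → t (suc j) zero))) (sum-zero first-row))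
                (trans (sum-cong-≋ (λ j → sum-cong-≋ (λ k → rest j k)))
                       (alternating-sum (λ j k → f (suc j) (suc k)) (f-sym ∘ ℕ.s≤s))) ⟩
    0# + 0#
      ≈⟨ +-identityʳ 0# ⟩
    0# ∎
    where
    t : Fin (suc (suc n)) → Fin (suc n) → Carrier
    t j k = sign j * (sign k * f j k)

    first-row : ∀ k → t zero k + t (suc k) zero ≈ 0#
    first-row k = trans (+-congʳ (*-congˡ (*-congˡ (f-sym {zero} {k} ℕ.z≤n))))
      (solve 2 (λ s x → con (+ 1) :* (s :* x) :+ :- con (+ 1) :* s :* (con (+ 1) :* x) := con (+ 0))
        refl (sign k) (f (suc k) zero))

    rest : ∀ j k → t (suc j) (suc k) ≈ sign j * (sign k * f (suc j) (suc k))
    rest j k = solve 3 (λ s u x → :- con (+ 1) :* s :* (:- con (+ 1) :* u :* x) := s :* (u :* x))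
      refl (sign j) (sign k) (f (suc j) (suc k))

  det : ∀ {n} → (Fin n → Fin n → Carrier) → Carrier
  det {zero}  M = 1#
  det {suc n} M = sum λ j → (- 1#) ^ toℕ j * M zero j * det (deleteRowCol zero j M)

  det-cong : ∀ {n} {M N : Fin n → Fin n → Carrier} → (∀ i j → M i j ≈ N i j) → det M ≈ det N
  det-cong {zero}  M≈N = refl
  det-cong {suc n} M≈N = sum-cong-≋ λ j →
    *-cong (*-congˡ {sign j} (M≈N zero j)) (det-cong (λ a b → M≈N (suc a) (punchIn j b)))

  -- This is `sign k` times the determinant of `M` with row `k` replaced by `r`.
  rowExpansion : ∀ {n} → Fin (suc n) → (Fin (suc n) → Fin (suc n) → Carrier) →
    Vector Carrier (suc n) → Carrier
  rowExpansion k M r = sum λ j → sign j * (r j * det (deleteRowCol k j M))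

  -- This is `sign k` times the determinant of `M` with row `zero` replaced by `r` and row `suc k`
  -- by `s`.
  twoRowExpansion : ∀ {n} → Fin (suc n) → (Fin (suc (suc n)) → Fin (suc (suc n)) → Carrier) →
    (r s : Vector Carrier (suc (suc n))) → Carrier
  twoRowExpansion k M r s = sum λ j → sum λ c → sign j * (sign c * (r j * s (punchIn j c) *
    det (deleteRowCol k c (deleteRowCol zero j M))))

  module _ {n} (k : Fin (suc n)) (M : Fin (suc (suc n)) → Fin (suc (suc n)) → Carrier) where

    private
      minor : Fin (suc (suc n)) → Fin (suc n) → Carrier
      minor j c = det (deleteRowCol k c (deleteRowCol zero j M))

      minor-sym : ∀ {j c} → j Fin.≤ c → minor (inject₁ j) c ≈ minor (suc c) j
      minor-sym j≤c = det-cong λ a b → reflexive (≡.cong (M _) (punchIn-comm j≤c b))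

    twoRowExpansion-equal : ∀ r → twoRowExpansion k M r r ≈ 0#
    twoRowExpansion-equal r = alternating-sum
      (λ j c → r j * r (punchIn j c) * minor j c)
      (λ {j} {c} j≤c → *-cong
        (trans (*-comm _ _) (reflexive (≡.cong₂ (λ a b → r a * r b) (punchIn-inject₁ j≤c) (≡.sym (punchIn-suc j≤c)))))
        (minor-sym j≤c))

    -- The summand symmetrised in `r` and `s` does not see the order of the two columns, so
    -- `alternating-sum` annihilates the sum of the two expansions.
    twoRowExpansion-antisym : ∀ r s → twoRowExpansion k M r s ≈ - twoRowExpansion k M s r
    twoRowExpansion-antisym r s = +-inverseˡ-unique _ _ (begin
      sum (λ j → sum (λ c → t r s j c)) + sum (λ j → sum (λ c → t s r j c))
        ≈⟨ ∑-distrib-+ (λ j → sum (t r s j)) (λ j → sum (t s r j)) ⟨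
      sum (λ j → sum (λ c → t r s j c) + sum (λ c → t s r j c))
        ≈⟨ sum-cong-≋ (λ j → sym (∑-distrib-+ (t r s j) (t s r j))) ⟩
      sum (λ j → sum (λ c → t r s j c + t s r j c))
        ≈⟨ sum-cong-≋ (λ j → sum-cong-≋ (λ c → solve 5
             (λ σ τ x y d → σ :* (τ :* (x :* d)) :+ σ :* (τ :* (y :* d)) := σ :* (τ :* ((x :+ y) :* d)))
             refl (sign j) (sign c) (r j * s (punchIn j c)) (s j * r (punchIn j c)) (minor j c))) ⟩
      sum (λ j → sum (λ c → sign j * (sign c * ((r j * s (punchIn j c) + s j * r (punchIn j c)) * minor j c))))
        ≈⟨ alternating-sum (λ j c → (r j * s (punchIn j c) + s j * r (punchIn j c)) * minor j c)
             (λ {j} {c} j≤c → *-cong (swap j≤c) (minor-sym j≤c)) ⟩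
      0# ∎)
      where
      t : (r s : Vector Carrier (suc (suc n))) → Fin (suc (suc n)) → Fin (suc n) → Carrier
      t r s j c = sign j * (sign c * (r j * s (punchIn j c) * minor j c))
      swap : ∀ {j c} → j Fin.≤ c →
        r (inject₁ j) * s (punchIn (inject₁ j) c) + s (inject₁ j) * r (punchIn (inject₁ j) c) ≈
        r (suc c) * s (punchIn (suc c) j) + s (suc c) * r (punchIn (suc c) j)
      swap {j} {c} j≤c rewrite punchIn-inject₁ j≤c | punchIn-suc j≤c =
        solve 4 (λ a b d e → a :* b :+ d :* e := e :* d :+ b :* a) refl
          (r (inject₁ j)) (s (suc c)) (s (inject₁ j)) (r (suc c))

    -- Expanding each minor along its top row, which is still `M zero`, is enough: deleting rows
    -- `suc k` and then `zero` agrees by computation with deleting `zero` and then `k`.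
    rowExpansion-suc : ∀ r → rowExpansion (suc k) M r ≈ twoRowExpansion k M r (M zero)
    rowExpansion-suc r = sum-cong-≋ λ j → begin
      sign j * (r j * sum (λ c → sign c * M zero (punchIn j c) * minor j c))
        ≈⟨ *-assoc _ _ _ ⟨
      sign j * r j * sum (λ c → sign c * M zero (punchIn j c) * minor j c)
        ≈⟨ *-distribˡ-sum (sign j * r j) (λ c → sign c * M zero (punchIn j c) * minor j c) ⟩
      sum (λ c → sign j * r j * (sign c * M zero (punchIn j c) * minor j c))
        ≈⟨ sum-cong-≋ (λ c → solve 5
             (λ σ x τ y d → σ :* x :* (τ :* y :* d) := σ :* (τ :* (x :* y :* d)))
             refl (sign j) (r j) (sign c) (M zero (punchIn j c)) (minor j c)) ⟩
      sum (λ c → sign j * (sign c * (r j * M zero (punchIn j c) * minor j c))) ∎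

    twoRowExpansion-minors : ∀ r s → twoRowExpansion k M r s ≈
      sum (λ j → sign j * (r j * rowExpansion k (deleteRowCol zero j M) (s ∘ punchIn j)))
    twoRowExpansion-minors r s = sum-cong-≋ λ j → begin
      sum (λ c → sign j * (sign c * (r j * s (punchIn j c) * minor j c)))
        ≈⟨ sum-cong-≋ (λ c → solve 5
             (λ σ x τ y d → σ :* (τ :* (x :* y :* d)) := σ :* x :* (τ :* (y :* d)))
             refl (sign j) (r j) (sign c) (s (punchIn j c)) (minor j c)) ⟩
      sum (λ c → sign j * r j * (sign c * (s (punchIn j c) * minor j c)))
        ≈⟨ *-distribˡ-sum (sign j * r j) (λ c → sign c * (s (punchIn j c) * minor j c)) ⟨
      sign j * r j * sum (λ c → sign c * (s (punchIn j c) * minor j c))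
        ≈⟨ *-assoc _ _ _ ⟩
      sign j * (r j * sum (λ c → sign c * (s (punchIn j c) * minor j c))) ∎

  rowExpansion-zero : ∀ {n} (M : Fin (suc n) → Fin (suc n) → Carrier) →
    rowExpansion zero M (M zero) ≈ det M
  rowExpansion-zero M = sum-cong-≋ λ j → sym (*-assoc (sign j) (M zero j) (det (deleteRowCol zero j M)))

  -- Interchanging rows `zero` and `suc k` in the double expansion puts row `zero` outside, and the
  -- induction hypothesis evaluates the inner expansions along row `k`. The interchange costs the
  -- one sign by which `sign (suc k)` differs from `sign k`.
  laplace : ∀ {n} (k : Fin (suc n)) M → rowExpansion k M (M k) ≈ sign k * det M
  laplace zero M = trans (rowExpansion-zero M) (sym (*-identityˡ _))
  laplace {suc n} (suc k) M = begin
    rowExpansion (suc k) M (M (suc k))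
      ≈⟨ rowExpansion-suc k M (M (suc k)) ⟩
    twoRowExpansion k M (M (suc k)) (M zero)
      ≈⟨ twoRowExpansion-antisym k M (M (suc k)) (M zero) ⟩
    - twoRowExpansion k M (M zero) (M (suc k))
      ≈⟨ -‿cong (twoRowExpansion-minors k M (M zero) (M (suc k))) ⟩
    - sum (λ j → sign j * (M zero j * rowExpansion k (P j) (P j k)))
      ≈⟨ -‿cong (sum-cong-≋ (λ j → begin
           sign j * (M zero j * rowExpansion k (P j) (P j k))
             ≈⟨ *-congˡ (*-congˡ (laplace k (P j))) ⟩
           sign j * (M zero j * (sign k * det (P j)))
             ≈⟨ solve 4 (λ σ x τ d → σ :* (x :* (τ :* d)) := τ :* (σ :* x :* d)) refl
                  (sign j) (M zero j) (sign k) (det (P j)) ⟩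
           sign k * (sign j * M zero j * det (P j)) ∎)) ⟩
    - sum (λ j → sign k * (sign j * M zero j * det (P j)))
      ≈⟨ -‿cong (*-distribˡ-sum (sign k) (λ j → sign j * M zero j * det (P j))) ⟨
    - (sign k * det M)
      ≈⟨ solve 2 (λ τ d → :- (τ :* d) := :- con (+ 1) :* τ :* d) refl (sign k) (det M) ⟩
    sign (suc k) * det M ∎
    where
    P : Fin (suc (suc n)) → Fin (suc n) → Fin (suc n) → Carrier
    P j = deleteRowCol zero j M

  -- The expansion belongs to a matrix whose rows `k` and `i` coincide. If one of them is row
  -- `zero`, this is `twoRowExpansion-equal`; otherwise induction applies to the minors of row
  -- `zero`.
  laplace-alien : ∀ {n} (k i : Fin (suc n)) M → k ≢ i → rowExpansion k M (M i) ≈ 0#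
  laplace-alien zero zero M k≢i = contradiction ≡.refl k≢i
  laplace-alien {suc n} zero (suc i) M k≢i = begin
    sum (λ j → sign j * (M (suc i) j * det (P j)))
      ≈⟨ sum-cong-≋ (λ j → begin
           sign j * (M (suc i) j * det (P j))
             ≈⟨ solve 3 (λ σ x d → σ :* (x :* d) := σ :* (x :* (con (+ 1) :* d))) refl
                  (sign j) (M (suc i) j) (det (P j)) ⟩
           sign j * (M (suc i) j * (1# * det (P j)))
             -- A square of `sign i` is inserted: one copy lets `laplace` expand the minor along its
             -- row `i`, which is row `suc i` of `M`, and the other is pulled out of the sum.
             ≈⟨ *-congˡ (*-congˡ (*-congʳ (sign*sign i))) ⟨
           sign j * (M (suc i) j * (sign i * sign i * det (P j)))
             ≈⟨ solve 4 (λ σ x τ d → σ :* (x :* (τ :* τ :* d)) := τ :* (σ :* (x :* (τ :* d)))) refl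
                  (sign j) (M (suc i) j) (sign i) (det (P j)) ⟩
           sign i * (sign j * (M (suc i) j * (sign i * det (P j))))
             ≈⟨ *-congˡ (*-congˡ (*-congˡ (laplace i (P j)))) ⟨
           sign i * (sign j * (M (suc i) j * rowExpansion i (P j) (P j i))) ∎) ⟩
    sum (λ j → sign i * (sign j * (M (suc i) j * rowExpansion i (P j) (P j i))))
      ≈⟨ *-distribˡ-sum (sign i) (λ j → sign j * (M (suc i) j * rowExpansion i (P j) (P j i))) ⟨
    sign i * sum (λ j → sign j * (M (suc i) j * rowExpansion i (P j) (P j i)))
      ≈⟨ *-congˡ (twoRowExpansion-minors i M (M (suc i)) (M (suc i))) ⟨
    sign i * twoRowExpansion i M (M (suc i)) (M (suc i))
      ≈⟨ *-congˡ (twoRowExpansion-equal i M (M (suc i))) ⟩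
    sign i * 0#
      ≈⟨ zeroʳ _ ⟩
    0# ∎
    where
    P : Fin (suc (suc n)) → Fin (suc n) → Fin (suc n) → Carrier
    P j = deleteRowCol zero j M
  laplace-alien {suc n} (suc k) zero M k≢i =
    trans (rowExpansion-suc k M (M zero)) (twoRowExpansion-equal k M (M zero))
  laplace-alien {suc n} (suc k) (suc i) M k≢i = begin
    rowExpansion (suc k) M (M (suc i))
      ≈⟨ rowExpansion-suc k M (M (suc i)) ⟩
    twoRowExpansion k M (M (suc i)) (M zero)
      ≈⟨ twoRowExpansion-antisym k M (M (suc i)) (M zero) ⟩
    - twoRowExpansion k M (M zero) (M (suc i))
      ≈⟨ -‿cong (twoRowExpansion-minors k M (M zero) (M (suc i))) ⟩
    - sum (λ j → sign j * (M zero j * rowExpansion k (deleteRowCol zero j M) (M (suc i) ∘ punchIn j)))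
      ≈⟨ -‿cong (sum-zero (λ j → trans
           (*-congˡ {sign j} (trans (*-congˡ {M zero j}
             (laplace-alien k i (deleteRowCol zero j M) (k≢i ∘ ≡.cong suc))) (zeroʳ _)))
           (zeroʳ _))) ⟩
    - 0#
      ≈⟨ -0#≈0# ⟩
    0# ∎

-- Axioms for the real and complex numbers

-- Tightness takes the place of a decidable sign, which the reals do not have.
record PositiveCone (R : CommutativeRing 0ℓ 0ℓ) : Set₁ where
  open CommutativeRing R
  field
    Pos      : Carrier → Set
    pos-resp : ∀ {x y} → x ≈ y → Pos x → Pos y
    pos-1    : Pos 1#
    +-pos    : ∀ {x y} → Pos x → Pos y → Pos (x + y)
    *-pos    : ∀ {x y} → Pos x → Pos y → Pos (x * y)
    ¬pos-0   : ¬ Pos 0#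
    tight    : ∀ {x} → ¬ Pos x → ¬ Pos (- x) → x ≈ 0#
    small    : ∀ K {c} → Pos c → ∃[ s ] (Pos s × Pos (1# - s) × Pos (c - s * K))

-- Specified by real and imaginary parts rather than built as pairs, so that the complex numbers of
-- the theorem, with their own ring operations, are an instance.
record ComplexStructure (R : CommutativeRing 0ℓ 0ℓ) : Set₁ where
  open CommutativeRing R
  field
    C : CommutativeRing 0ℓ 0ℓ
  open CommutativeRing C public using () renaming
    (Carrier to ℂ; _≈_ to _≈ᶜ_; _+_ to _⊕_; _*_ to _⊗_; -_ to ⊖_; _-_ to _⊝_; 0# to 0ᶜ; 1# to 1ᶜ)
  field
    re im   : ℂ → Carrier
    _+i_    : Carrier → Carrier → ℂ
    re-cong : ∀ {z w} → z ≈ᶜ w → re z ≈ re w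
    im-cong : ∀ {z w} → z ≈ᶜ w → im z ≈ im w
    ext     : ∀ {z w} → re z ≈ re w → im z ≈ im w → z ≈ᶜ w
    re-+i   : ∀ x y → re (x +i y) ≈ x
    im-+i   : ∀ x y → im (x +i y) ≈ y
    re-⊕    : ∀ z w → re (z ⊕ w) ≈ re z + re w
    im-⊕    : ∀ z w → im (z ⊕ w) ≈ im z + im w
    re-⊖    : ∀ z → re (⊖ z) ≈ - re z
    im-⊖    : ∀ z → im (⊖ z) ≈ - im z
    re-⊗    : ∀ z w → re (z ⊗ w) ≈ re z * re w - im z * im w
    im-⊗    : ∀ z w → im (z ⊗ w) ≈ re z * im w + im z * re w
    re-0    : re 0ᶜ ≈ 0#
    im-0    : im 0ᶜ ≈ 0#
    re-1    : re 1ᶜ ≈ 1#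
    im-1    : im 1ᶜ ≈ 0#

-- Finiteness is essential: for infinite index sets this is the double-negation shift, which is not
-- constructively provable.
¬¬-finite : ∀ {n} {P : Fin n → Set} → (∀ i → ¬ ¬ P i) → ¬ ¬ (∀ i → P i)
¬¬-finite = Fin.sequence (RawMonad.rawApplicative ¬¬-Monad)

-- Sign arguments under double negation

module Order {R : CommutativeRing 0ℓ 0ℓ} (P : PositiveCone R) where
  open CommutativeRing R hiding (zero)
  open PositiveCone P
  open RingProperties ring
  open IntegerCoefficients R
  open MonoidSum *-commutativeMonoid public using () renaming
    (sum to product; sum-remove to product-remove; sum-cong-≋ to product-cong; ∑-distrib-+ to product-distrib-*)

  -- A negation by definition, hence stable under `¬¬`: a proof of `NonNeg` may argue by the sign of
  -- any real.
  NonNeg : Carrier → Set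
  NonNeg x = ¬ Pos (- x)

  infix 4 _<_ _≤_
  _<_ _≤_ : Carrier → Carrier → Set
  x < y = Pos (y - x)
  x ≤ y = NonNeg (y - x)

  trichotomy : ∀ x → ¬ ¬ (Pos x ⊎ x ≈ 0# ⊎ Pos (- x))
  trichotomy x k = k (inj₂ (inj₁ (tight (k ∘ inj₁) (k ∘ inj₂ ∘ inj₂))))

  nonNeg-resp : ∀ {x y} → x ≈ y → NonNeg x → NonNeg y
  nonNeg-resp x≈y x≥0 = x≥0 ∘ pos-resp (-‿cong (sym x≈y))

  pos⇒nonNeg : ∀ {x} → Pos x → NonNeg x
  pos⇒nonNeg {x} x>0 -x>0 = ¬pos-0 (pos-resp (-‿inverseʳ x) (+-pos x>0 -x>0))

  nonNeg-0 : NonNeg 0#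
  nonNeg-0 = ¬pos-0 ∘ pos-resp -0#≈0#

  pos⇒≉0 : ∀ {x} → Pos x → ¬ (x ≈ 0#)
  pos⇒≉0 x>0 x≈0 = ¬pos-0 (pos-resp x≈0 x>0)

  nonNeg-cases : ∀ {x} → NonNeg x → ¬ ¬ (Pos x ⊎ x ≈ 0#)
  nonNeg-cases x≥0 k = k (inj₂ (tight (k ∘ inj₁) x≥0))

  nonNeg-elim : ∀ {x y} → NonNeg x → (Pos x → NonNeg y) → (x ≈ 0# → NonNeg y) → NonNeg y
  nonNeg-elim x≥0 f g -y>0 = nonNeg-cases x≥0 λ
    { (inj₁ x>0) → f x>0 -y>0
    ; (inj₂ x≈0) → g x≈0 -y>0 }

  +-nonNeg : ∀ {x y} → NonNeg x → NonNeg y → NonNeg (x + y)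
  +-nonNeg {x} {y} x≥0 y≥0 = nonNeg-elim x≥0
    (λ x>0 → nonNeg-elim y≥0
      (λ y>0 → pos⇒nonNeg (+-pos x>0 y>0))
      (λ y≈0 → pos⇒nonNeg (pos-resp (sym (trans (+-congˡ y≈0) (+-identityʳ x))) x>0)))
    (λ x≈0 → nonNeg-resp (sym (trans (+-congʳ x≈0) (+-identityˡ y))) y≥0)

  *-nonNeg : ∀ {x y} → NonNeg x → NonNeg y → NonNeg (x * y)
  *-nonNeg {x} {y} x≥0 y≥0 = nonNeg-elim x≥0
    (λ x>0 → nonNeg-elim y≥0
      (λ y>0 → pos⇒nonNeg (*-pos x>0 y>0))
      (λ y≈0 → nonNeg-resp (sym (trans (*-congˡ y≈0) (zeroʳ x))) nonNeg-0))
    (λ x≈0 → nonNeg-resp (sym (trans (*-congʳ x≈0) (zeroˡ y))) nonNeg-0)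

  neg*neg-pos : ∀ {x y} → Pos (- x) → Pos (- y) → Pos (x * y)
  neg*neg-pos {x} {y} -x>0 -y>0 = pos-resp
    (solve 2 (λ x y → :- x :* :- y := x :* y) refl x y) (*-pos -x>0 -y>0)

  pos*neg : ∀ {x y} → Pos x → Pos (- y) → Pos (- (x * y))
  pos*neg {x} {y} x>0 -y>0 = pos-resp (sym (-‿distribʳ-* x y)) (*-pos x>0 -y>0)

  square-nonNeg : ∀ x → NonNeg (x * x)
  square-nonNeg x -xx>0 = trichotomy x λ
    { (inj₁ x>0)        → pos⇒nonNeg (*-pos x>0 x>0) -xx>0
    ; (inj₂ (inj₁ x≈0)) → nonNeg-resp (sym (trans (*-congʳ x≈0) (zeroˡ x))) nonNeg-0 -xx>0
    ; (inj₂ (inj₂ x<0)) → pos⇒nonNeg (neg*neg-pos x<0 x<0) -xx>0 }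

  pos+nonNeg : ∀ {x y} → Pos x → NonNeg y → ¬ ¬ Pos (x + y)
  pos+nonNeg {x} x>0 y≥0 k = nonNeg-cases y≥0 λ
    { (inj₁ y>0) → k (+-pos x>0 y>0)
    ; (inj₂ y≈0) → k (pos-resp (sym (trans (+-congˡ y≈0) (+-identityʳ x))) x>0) }

  *-cancel-nonNeg : ∀ {s x} → Pos s → NonNeg (s * x) → NonNeg x
  *-cancel-nonNeg s>0 sx≥0 -x>0 = sx≥0 (pos*neg s>0 -x>0)

  double-cancel-nonNeg : ∀ {x} → NonNeg (x + x) → NonNeg x
  double-cancel-nonNeg {x} 2x≥0 -x>0 = 2x≥0 (pos-resp (-‿+-comm x x) (+-pos -x>0 -x>0))

  sum-nonNeg : ∀ {n} {v : Vector Carrier n} → (∀ i → NonNeg (v i)) → NonNeg (SemiringSum.sum semiring v)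
  sum-nonNeg {zero}  v≥0 = nonNeg-0
  sum-nonNeg {suc n} v≥0 = +-nonNeg (v≥0 zero) (sum-nonNeg (v≥0 ∘ suc))

  <⇒≤ : ∀ {x y} → x < y → x ≤ y
  <⇒≤ = pos⇒nonNeg

  ≤-reflexive : ∀ {x y} → x ≈ y → x ≤ y
  ≤-reflexive {x} {y} x≈y = nonNeg-resp (sym (trans (+-congˡ (-‿cong x≈y)) (-‿inverseʳ y))) nonNeg-0

  ≤-trans : ∀ {x y z} → x ≤ y → y ≤ z → x ≤ z
  ≤-trans {x} {y} {z} x≤y y≤z = nonNeg-resp
    (solve 3 (λ x y z → (y :- x) :+ (z :- y) := z :- x) refl x y z) (+-nonNeg x≤y y≤z)

  neg-minus : ∀ x y → - (x - y) ≈ y - x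
  neg-minus = solve 2 (λ x y → :- (x :- y) := y :- x) refl

  <⇒≱ : ∀ {x y} → x < y → ¬ (y ≤ x)
  <⇒≱ {x} {y} x<y y≤x = y≤x (pos-resp (sym (neg-minus x y)) x<y)

  product-pos : ∀ {n} {v : Vector Carrier n} → (∀ i → Pos (v i)) → Pos (product v)
  product-pos {zero}  v>0 = pos-1
  product-pos {suc n} v>0 = *-pos (v>0 zero) (product-pos (v>0 ∘ suc))

  product-neg : ∀ {n} {v : Vector Carrier n} i → Pos (- v i) → (∀ j → j ≢ i → Pos (v j)) →
    Pos (- product v)
  product-neg {suc n} {v} i vi<0 v>0 = pos-resp
    (trans (sym (-‿distribˡ-* _ _)) (-‿cong (sym (product-remove v))))
    (*-pos vi<0 (product-pos (λ l → v>0 (punchIn i l) (Fin.punchInᵢ≢i i l))))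

  product-zero : ∀ {n} {v : Vector Carrier n} i → v i ≈ 0# → product v ≈ 0#
  product-zero {suc n} {v} i vi≈0 = trans (product-remove v) (trans (*-congʳ vi≈0) (zeroˡ _))

  -- Such an `x` has `p` and `q` strictly on the same side. In `gap-occupied` this makes the factors
  -- coming from points outside a gap positive.
  outside-interval : ∀ {p q x} → p ≤ q → ¬ (p < x × x < q) → ¬ (p ≈ x) → ¬ (q ≈ x) →
    ¬ ¬ Pos ((p - x) * (q - x))
  outside-interval {p} {q} {x} p≤q x∉ p≉x q≉x k = trichotomy (p - x) λ
    { (inj₂ (inj₁ p≈x)) → p≉x (x-y≈0⇒x≈y p≈x)
    ; (inj₁ x<p)        → trichotomy (q - x) λ
      { (inj₂ (inj₁ q≈x)) → q≉x (x-y≈0⇒x≈y q≈x)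
      ; (inj₁ x<q)        → k (*-pos x<p x<q)
      ; (inj₂ (inj₂ q<x)) → p≤q (pos-resp
          (solve 3 (λ p q x → (p :- x) :+ :- (q :- x) := :- (q :- p)) refl p q x) (+-pos x<p q<x)) }
    ; (inj₂ (inj₂ p<x)) → trichotomy (q - x) λ
      { (inj₂ (inj₁ q≈x)) → q≉x (x-y≈0⇒x≈y q≈x)
      ; (inj₁ x<q)        → x∉ (pos-resp (neg-minus p x) p<x , x<q)
      ; (inj₂ (inj₂ q<x)) → k (neg*neg-pos p<x q<x) } }
    where
    x-y≈0⇒x≈y : ∀ {x y} → x - y ≈ 0# → x ≈ y
    x-y≈0⇒x≈y {x} {y} eq = trans (solve 2 (λ x y → x := (x :- y) :+ y) refl x y)
      (trans (+-congʳ eq) (+-identityˡ y))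

-- The inner product of the complex plane and one-sided limits

module FirstOrderExpansions {c ℓ} (R : CommutativeRing c ℓ) where
  open CommutativeRing R
  open IntegerCoefficients R

  -- These identities are proved for a general ring because they are applied to complex numbers,
  -- whereas the solver opened in the modules below is that of the reals.
  product-expansion : ∀ c d σ r t →
    (c + σ * r) * (d + σ * t) ≈ c * d + σ * ((c * t + d * r) + σ * (r * t))
  product-expansion = solve 5 (λ c d σ r t →
    (c :+ σ :* r) :* (d :+ σ :* t) := c :* d :+ σ :* ((c :* t :+ d :* r) :+ σ :* (r :* t))) refl

  -- The remainder is `r + - 1# * t`, not `r - t`, so that its bound comes from the rules for sums,
  -- products and constants.
  difference-expansion : ∀ c d σ r t →
    (c + σ * r) - (d + σ * t) ≈ (c - d) + σ * (r + - 1# * t)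
  difference-expansion = solve 5 (λ c d σ r t →
    (c :+ σ :* r) :- (d :+ σ :* t) := (c :- d) :+ σ :* (r :+ (:- con (+ 1)) :* t)) refl

  shift-difference : ∀ x σ y → (x + σ) - y ≈ (x - y) + σ
  shift-difference = solve 3 (λ x σ y → (x :+ σ) :- y := (x :- y) :+ σ) refl

  shift-self : ∀ x σ → (x + σ) - x ≈ σ
  shift-self = solve 2 (λ x σ → (x :+ σ) :- x := σ) refl

module Complex {R : CommutativeRing 0ℓ 0ℓ} (P : PositiveCone R) (CS : ComplexStructure R) where
  open CommutativeRing R hiding (zero)
  open PositiveCone P
  open ComplexStructure CS
  open IntegerCoefficients R
  open Order P
  open SetoidReasoning setoid
  private module C where
    open CommutativeRing C public
    open FirstOrderExpansions C public
  open MonoidSum C.*-commutativeMonoid public using () renaming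
    (sum to ∏; sum-remove to ∏-remove; sum-cong-≋ to ∏-cong)

  ι : Carrier → ℂ
  ι x = x +i 0#

  -- The real part of `z` times the conjugate of `w`. `N` is the squared modulus, which needs no
  -- square root.
  ⟨_,_⟩ : ℂ → ℂ → Carrier
  ⟨ z , w ⟩ = re z * re w + im z * im w

  N : ℂ → Carrier
  N z = ⟨ z , z ⟩

  inner-cong : ∀ {z z′ w w′} → z ≈ᶜ z′ → w ≈ᶜ w′ → ⟨ z , w ⟩ ≈ ⟨ z′ , w′ ⟩
  inner-cong z≈z′ w≈w′ = +-cong (*-cong (re-cong z≈z′) (re-cong w≈w′)) (*-cong (im-cong z≈z′) (im-cong w≈w′))

  N-cong : ∀ {z w} → z ≈ᶜ w → N z ≈ N w
  N-cong z≈w = inner-cong z≈w z≈w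

  re-⊝ : ∀ z w → re (z ⊝ w) ≈ re z - re w
  re-⊝ z w = trans (re-⊕ z (⊖ w)) (+-congˡ (re-⊖ w))

  im-⊝ : ∀ z w → im (z ⊝ w) ≈ im z - im w
  im-⊝ z w = trans (im-⊕ z (⊖ w)) (+-congˡ (im-⊖ w))

  re-ι⊗ : ∀ x z → re (ι x ⊗ z) ≈ x * re z
  re-ι⊗ x z = begin
    re (ι x ⊗ z)                          ≈⟨ re-⊗ (ι x) z ⟩
    re (ι x) * re z - im (ι x) * im z     ≈⟨ +-cong (*-congʳ (re-+i x 0#)) (-‿cong (*-congʳ (im-+i x 0#))) ⟩
    x * re z - 0# * im z                  ≈⟨ solve 3 (λ x a b → x :* a :- con (+ 0) :* b := x :* a) refl x (re z) (im z) ⟩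
    x * re z                              ∎

  im-ι⊗ : ∀ x z → im (ι x ⊗ z) ≈ x * im z
  im-ι⊗ x z = begin
    im (ι x ⊗ z)                          ≈⟨ im-⊗ (ι x) z ⟩
    re (ι x) * im z + im (ι x) * re z     ≈⟨ +-cong (*-congʳ (re-+i x 0#)) (*-congʳ (im-+i x 0#)) ⟩
    x * im z + 0# * re z                  ≈⟨ solve 3 (λ x a b → x :* b :+ con (+ 0) :* a := x :* b) refl x (re z) (im z) ⟩
    x * im z                              ∎

  inner-⊗ : ∀ c z w → ⟨ c ⊗ z , c ⊗ w ⟩ ≈ N c * ⟨ z , w ⟩
  inner-⊗ c z w = trans
    (+-cong (*-cong (re-⊗ c z) (re-⊗ c w)) (*-cong (im-⊗ c z) (im-⊗ c w)))
    (solve 6 (λ a b x y u v →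
      (a :* x :- b :* y) :* (a :* u :- b :* v) :+ (a :* y :+ b :* x) :* (a :* v :+ b :* u) :=
      (a :* a :+ b :* b) :* (x :* u :+ y :* v)) refl (re c) (im c) (re z) (im z) (re w) (im w))

  inner-self-⊗ : ∀ z w → ⟨ w , z ⊗ w ⟩ ≈ re z * N w
  inner-self-⊗ z w = trans (+-cong (*-congˡ (re-⊗ z w)) (*-congˡ (im-⊗ z w)))
    (solve 4 (λ a b x y → x :* (a :* x :- b :* y) :+ y :* (a :* y :+ b :* x) :=
      a :* (x :* x :+ y :* y)) refl (re z) (im z) (re w) (im w))

  inner-ιˡ : ∀ x z w → ⟨ ι x ⊗ z , w ⟩ ≈ x * ⟨ z , w ⟩
  inner-ιˡ x z w = trans (+-cong (*-congʳ (re-ι⊗ x z)) (*-congʳ (im-ι⊗ x z)))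
    (solve 5 (λ x a b c d → x :* a :* c :+ x :* b :* d := x :* (a :* c :+ b :* d)) refl
      x (re z) (im z) (re w) (im w))

  inner-sym : ∀ z w → ⟨ z , w ⟩ ≈ ⟨ w , z ⟩
  inner-sym z w = +-cong (*-comm _ _) (*-comm _ _)

  inner-ιʳ : ∀ x z w → ⟨ z , ι x ⊗ w ⟩ ≈ x * ⟨ z , w ⟩
  inner-ιʳ x z w = trans (inner-sym _ _) (trans (inner-ιˡ x w z) (*-congˡ (inner-sym w z)))

  inner-⊕ˡ : ∀ z z′ w → ⟨ z ⊕ z′ , w ⟩ ≈ ⟨ z , w ⟩ + ⟨ z′ , w ⟩
  inner-⊕ˡ z z′ w = trans (+-cong (*-congʳ (re-⊕ z z′)) (*-congʳ (im-⊕ z z′)))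
    (solve 6 (λ a b c d x y → (a :+ c) :* x :+ (b :+ d) :* y := (a :* x :+ b :* y) :+ (c :* x :+ d :* y)) refl
      (re z) (im z) (re z′) (im z′) (re w) (im w))

  inner-⊕ʳ : ∀ z w w′ → ⟨ z , w ⊕ w′ ⟩ ≈ ⟨ z , w ⟩ + ⟨ z , w′ ⟩
  inner-⊕ʳ z w w′ = trans (inner-sym _ _) (trans (inner-⊕ˡ w w′ z) (+-cong (inner-sym w z) (inner-sym w′ z)))

  inner-⊝ʳ : ∀ z w w′ → ⟨ z , w ⊝ w′ ⟩ ≈ ⟨ z , w ⟩ - ⟨ z , w′ ⟩
  inner-⊝ʳ z w w′ = trans (+-cong (*-congˡ (re-⊝ w w′)) (*-congˡ (im-⊝ w w′)))
    (solve 6 (λ a b c d x y → a :* (c :- x) :+ b :* (d :- y) := (a :* c :+ b :* d) :- (a :* x :+ b :* y)) refl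
      (re z) (im z) (re w) (im w) (re w′) (im w′))

  inner-⊝ˡ : ∀ z z′ w → ⟨ z ⊝ z′ , w ⟩ ≈ ⟨ z , w ⟩ - ⟨ z′ , w ⟩
  inner-⊝ˡ z z′ w = trans (inner-sym _ _) (trans (inner-⊝ʳ w z z′)
    (+-cong (inner-sym w z) (-‿cong (inner-sym w z′))))

  inner-0ʳ : ∀ z → ⟨ z , 0ᶜ ⟩ ≈ 0#
  inner-0ʳ z = trans (+-cong (*-congˡ re-0) (*-congˡ im-0))
    (solve 2 (λ a b → a :* con (+ 0) :+ b :* con (+ 0) := con (+ 0)) refl (re z) (im z))

  N-⊗ : ∀ z w → N (z ⊗ w) ≈ N z * N w
  N-⊗ z w = inner-⊗ z w w

  N-1 : N 1ᶜ ≈ 1#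
  N-1 = trans (+-cong (*-cong re-1 re-1) (*-cong im-1 im-1))
    (solve 0 (con (+ 1) :* con (+ 1) :+ con (+ 0) :* con (+ 0) := con (+ 1)) refl)

  N-ι : ∀ x → N (ι x) ≈ x * x
  N-ι x = trans (+-cong (*-cong (re-+i x 0#) (re-+i x 0#)) (*-cong (im-+i x 0#) (im-+i x 0#)))
    (solve 1 (λ x → x :* x :+ con (+ 0) :* con (+ 0) := x :* x) refl x)

  N-nonNeg : ∀ z → NonNeg (N z)
  N-nonNeg z = +-nonNeg (square-nonNeg (re z)) (square-nonNeg (im z))

  square-pos : ∀ {x} → ¬ (x ≈ 0#) → ¬ ¬ Pos (x * x)
  square-pos {x} x≉0 k = trichotomy x λ
    { (inj₁ x>0)        → k (*-pos x>0 x>0)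
    ; (inj₂ (inj₁ x≈0)) → x≉0 x≈0
    ; (inj₂ (inj₂ x<0)) → k (neg*neg-pos x<0 x<0) }

  re-pos⇒N-pos : ∀ {z} → Pos (re z) → ¬ ¬ Pos (N z)
  re-pos⇒N-pos {z} re>0 = pos+nonNeg (*-pos re>0 re>0) (square-nonNeg (im z))

  N-pos : ∀ {z} → ¬ (z ≈ᶜ 0ᶜ) → ¬ ¬ Pos (N z)
  N-pos {z} z≉0 k = ¬¬-excluded-middle λ
    { (yes re≈0) → square-pos (λ im≈0 → z≉0 (ext (trans re≈0 (sym re-0)) (trans im≈0 (sym im-0))))
        (λ im²>0 → pos+nonNeg im²>0 (square-nonNeg (re z)) (k ∘ pos-resp (+-comm _ _)))
    ; (no re≉0) → square-pos re≉0 (λ re²>0 → pos+nonNeg re²>0 (square-nonNeg (im z)) k) }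

  ∏-zero : ∀ {n} {v : Vector ℂ n} i → v i ≈ᶜ 0ᶜ → ∏ v ≈ᶜ 0ᶜ
  ∏-zero {suc n} {v} i vi≈0 = C.trans (∏-remove v) (C.trans (C.*-congʳ vi≈0) (C.zeroˡ _))

  N-∏-pos : ∀ {n} {v : Vector ℂ n} → (∀ i → Pos (N (v i))) → Pos (N (∏ v))
  N-∏-pos {zero}      v>0 = pos-resp (sym N-1) pos-1
  N-∏-pos {suc n} {v} v>0 = pos-resp (sym (N-⊗ (v zero) (∏ (v ∘ suc)))) (*-pos (v>0 zero) (N-∏-pos (v>0 ∘ suc)))

  inner-imaginary : ∀ {x y} → re x ≈ 0# → re y ≈ 0# → ∀ z w → ⟨ x ⊗ z , y ⊗ w ⟩ ≈ im x * im y * ⟨ z , w ⟩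
  inner-imaginary {x} {y} rx≈0 ry≈0 z w = begin
    ⟨ x ⊗ z , y ⊗ w ⟩
      ≈⟨ +-cong (*-cong (re-⊗ x z) (re-⊗ y w)) (*-cong (im-⊗ x z) (im-⊗ y w)) ⟩
    (re x * re z - im x * im z) * (re y * re w - im y * im w) +
    (re x * im z + im x * re z) * (re y * im w + im y * re w)
      ≈⟨ +-cong (*-cong (+-congʳ (*-congʳ rx≈0)) (+-congʳ (*-congʳ ry≈0)))
                (*-cong (+-congʳ (*-congʳ rx≈0)) (+-congʳ (*-congʳ ry≈0))) ⟩
    (0# * re z - im x * im z) * (0# * re w - im y * im w) +
    (0# * im z + im x * re z) * (0# * im w + im y * re w)
      ≈⟨ solve 6 (λ a b p q u v →
           (con (+ 0) :* p :- a :* q) :* (con (+ 0) :* u :- b :* v) :+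
           (con (+ 0) :* q :+ a :* p) :* (con (+ 0) :* v :+ b :* u) :=
           a :* b :* (p :* u :+ q :* v)) refl (im x) (im y) (re z) (im z) (re w) (im w) ⟩
    im x * im y * ⟨ z , w ⟩ ∎

  -- For imaginary x and y the product x ȳ is the real number `im x * im y`, so taking real parts
  -- commutes with the product.
  inner-∏-imaginary : ∀ {n} {x y : Vector ℂ n} → (∀ l → re (x l) ≈ 0#) → (∀ l → re (y l) ≈ 0#) →
    ⟨ ∏ x , ∏ y ⟩ ≈ product (λ l → im (x l) * im (y l))
  inner-∏-imaginary {zero}          rx ry = N-1
  inner-∏-imaginary {suc n} {x} {y} rx ry = trans
    (inner-imaginary (rx zero) (ry zero) (∏ (x ∘ suc)) (∏ (y ∘ suc)))
    (*-congˡ (inner-∏-imaginary (rx ∘ suc) (ry ∘ suc)))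

  -- A crude stand-in for Cauchy-Schwarz without square roots: twice the difference of the two sides
  -- is |z - w|² + |z|² + |w|².
  inner≤N+N : ∀ z w → ⟨ z , w ⟩ ≤ N z + N w
  inner≤N+N z w = double-cancel-nonNeg (nonNeg-resp
    (solve 4 (λ a b c d →
       ((a :- c) :* (a :- c) :+ (b :- d) :* (b :- d)) :+ ((a :* a :+ b :* b) :+ (c :* c :+ d :* d)) :=
       (((a :* a :+ b :* b) :+ (c :* c :+ d :* d)) :- (a :* c :+ b :* d)) :+
       (((a :* a :+ b :* b) :+ (c :* c :+ d :* d)) :- (a :* c :+ b :* d)))
     refl (re z) (im z) (re w) (im w))
    (+-nonNeg (+-nonNeg (square-nonNeg (re z - re w)) (square-nonNeg (im z - im w)))
              (+-nonNeg (N-nonNeg z) (N-nonNeg w))))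

  -- The parallelogram law: the difference of the two sides is |z - w|².
  N-⊕-bound : ∀ z w → N (z ⊕ w) ≤ (N z + N w) + (N z + N w)
  N-⊕-bound z w = nonNeg-resp
    (trans
      (solve 4 (λ a b c d →
        (a :- c) :* (a :- c) :+ (b :- d) :* (b :- d) :=
        (((a :* a :+ b :* b) :+ (c :* c :+ d :* d)) :+ ((a :* a :+ b :* b) :+ (c :* c :+ d :* d)))
        :- ((a :+ c) :* (a :+ c) :+ (b :+ d) :* (b :+ d)))
       refl (re z) (im z) (re w) (im w))
      (+-congˡ (-‿cong (sym (+-cong (*-cong (re-⊕ z w) (re-⊕ z w)) (*-cong (im-⊕ z w) (im-⊕ z w)))))))
    (+-nonNeg (square-nonNeg (re z - re w)) (square-nonNeg (im z - im w)))

  +-mono-≤ : ∀ {x y u v} → x ≤ y → u ≤ v → x + u ≤ y + v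
  +-mono-≤ {x} {y} {u} {v} x≤y u≤v = nonNeg-resp
    (solve 4 (λ x y u v → (y :- x) :+ (v :- u) := (y :+ v) :- (x :+ u)) refl x y u v)
    (+-nonNeg x≤y u≤v)

  InUnitInterval : Carrier → Set
  InUnitInterval s = 0# < s × s < 1#

  *-mono-≤ : ∀ {x y u v} → NonNeg x → NonNeg u → x ≤ y → u ≤ v → x * u ≤ y * v
  *-mono-≤ {x} {y} {u} {v} x≥0 u≥0 x≤y u≤v = nonNeg-resp
    (solve 4 (λ x y u v → (y :- x) :* (v :- u) :+ ((y :- x) :* u :+ x :* (v :- u)) := y :* v :- x :* u) refl x y u v)
    (+-nonNeg (*-nonNeg x≤y u≤v) (+-nonNeg (*-nonNeg x≤y u≥0) (*-nonNeg x≥0 u≤v)))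

  Bounded : (Carrier → ℂ) → Set
  Bounded r = ∃[ K ] (∀ {s} → InUnitInterval s → N (r s) ≤ K)

  bounded-const : ∀ c → Bounded (λ _ → c)
  bounded-const c = N c , λ _ → ≤-reflexive refl

  bounded-⊕ : ∀ {r t} → Bounded r → Bounded t → Bounded (λ s → r s ⊕ t s)
  bounded-⊕ {r} {t} (K , r≤K) (L , t≤L) = (K + L) + (K + L) , λ {s} s∈ → ≤-trans
    (N-⊕-bound (r s) (t s)) (+-mono-≤ (+-mono-≤ (r≤K s∈) (t≤L s∈)) (+-mono-≤ (r≤K s∈) (t≤L s∈)))

  bounded-⊗ : ∀ {r t} → Bounded r → Bounded t → Bounded (λ s → r s ⊗ t s)
  bounded-⊗ {r} {t} (K , r≤K) (L , t≤L) = K * L , λ {s} s∈ → ≤-trans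
    (≤-reflexive (N-⊗ (r s) (t s))) (*-mono-≤ (N-nonNeg (r s)) (N-nonNeg (t s)) (r≤K s∈) (t≤L s∈))

  bounded-ι : Bounded ι
  bounded-ι = 1# * 1# , λ {s} (s>0 , s<1) →
    let s≥0 = nonNeg-resp (solve 1 (λ s → s :- con (+ 0) := s) refl s) (<⇒≤ s>0) in
    ≤-trans (≤-reflexive (N-ι s)) (*-mono-≤ s≥0 s≥0 (<⇒≤ s<1) (<⇒≤ s<1))

  -- This is `f s = c + O(s)` as s → 0⁺. The equation holds for every `s`; only the bound on the
  -- remainder is confined to 0 < s < 1.
  record Expansion (f : Carrier → ℂ) (c : ℂ) : Set where
    field
      remainder : Carrier → ℂ
      bounded   : Bounded remainder
      expand    : ∀ s → f s ≈ᶜ c ⊕ ι s ⊗ remainder s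

  expansion-const : ∀ c → Expansion (λ _ → c) c
  expansion-const c = record
    { remainder = λ _ → 0ᶜ
    ; bounded   = bounded-const 0ᶜ
    ; expand    = λ s → C.sym (C.trans (C.+-congˡ (C.zeroʳ (ι s))) (C.+-identityʳ c)) }

  expansion-linear : ∀ c → Expansion (λ s → c ⊕ ι s) c
  expansion-linear c = record
    { remainder = λ _ → 1ᶜ
    ; bounded   = bounded-const 1ᶜ
    ; expand    = λ s → C.+-congˡ (C.sym (C.*-identityʳ (ι s))) }

  expansion-⊗ : ∀ {f g c d} → Expansion f c → Expansion g d → Expansion (λ s → f s ⊗ g s) (c ⊗ d)
  expansion-⊗ {f} {g} {c} {d} F G = record
    { remainder = λ s → (c ⊗ t s ⊕ d ⊗ r s) ⊕ ι s ⊗ (r s ⊗ t s)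
    ; bounded   = bounded-⊕
        (bounded-⊕ (bounded-⊗ (bounded-const c) (bounded G)) (bounded-⊗ (bounded-const d) (bounded F)))
        (bounded-⊗ bounded-ι (bounded-⊗ (bounded F) (bounded G)))
    ; expand    = λ s → C.trans (C.*-cong (expand F s) (expand G s)) (C.product-expansion c d (ι s) (r s) (t s)) }
    where
    open Expansion
    r = remainder F
    t = remainder G

  expansion-∏ : ∀ {n} (c : Vector ℂ n) → Expansion (λ s → ∏ (λ l → c l ⊕ ι s)) (∏ c)
  expansion-∏ {zero}  c = expansion-const 1ᶜ
  expansion-∏ {suc n} c = expansion-⊗ (expansion-linear (c zero)) (expansion-∏ (c ∘ suc))

  expansion-⊝ : ∀ {f g c d} → Expansion f c → Expansion g d → Expansion (λ s → f s ⊝ g s) (c ⊝ d)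
  expansion-⊝ {f} {g} {c} {d} F G = record
    { remainder = λ s → r s ⊕ ⊖ 1ᶜ ⊗ t s
    ; bounded   = bounded-⊕ (bounded F) (bounded-⊗ (bounded-const (⊖ 1ᶜ)) (bounded G))
    ; expand    = λ s → C.trans (C.+-cong (expand F s) (C.-‿cong (expand G s)))
        (C.difference-expansion c d (ι s) (r s) (t s)) }
    where
    open Expansion
    r = remainder F
    t = remainder G

  -- By the expansions `⟨ f s , g s ⟩` is `⟨ c , d ⟩ + s * slope s` with `slope s ≤ B`. If
  -- `⟨ c , d ⟩` were negative, the `s` that `small` supplies with `s * B < - ⟨ c , d ⟩` would make
  -- the inner product negative as well.
  inner-limit : ∀ {f g c d} → Expansion f c → Expansion g d →
    (∀ {s} → InUnitInterval s → NonNeg ⟨ f s , g s ⟩) → NonNeg ⟨ c , d ⟩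
  inner-limit {f} {g} {c} {d} F G f·g≥0 cd<0 = contradict (small B cd<0)
    where
    open Expansion
    K L B : Carrier
    K = proj₁ (bounded F)
    L = proj₁ (bounded G)
    -- One summand for each term of `slope`, by `inner≤N+N`; in the last one the factor `s` is
    -- estimated by 1.
    B = (N c + L) + (K + N d) + (K + L)

    slope : Carrier → Carrier
    slope s = ⟨ c , remainder G s ⟩ + ⟨ remainder F s , d ⟩ + s * ⟨ remainder F s , remainder G s ⟩

    slope≤B : ∀ {s} → InUnitInterval s → NonNeg s → slope s ≤ B
    slope≤B {s} s∈ s≥0 = +-mono-≤
      (+-mono-≤ (≤-trans (inner≤N+N c t) (+-mono-≤ (≤-reflexive refl) t≤L))
                (≤-trans (inner≤N+N r d) (+-mono-≤ r≤K (≤-reflexive refl))))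
      (≤-trans
        (nonNeg-resp (solve 3 (λ s x y → s :* (y :- x) := s :* y :- s :* x) refl s ⟨ r , t ⟩ (N r + N t))
          (*-nonNeg s≥0 (inner≤N+N r t)))
        (≤-trans
          (*-mono-≤ s≥0 (+-nonNeg (N-nonNeg r) (N-nonNeg t)) (<⇒≤ (proj₂ s∈)) (+-mono-≤ r≤K t≤L))
          (≤-reflexive (*-identityˡ (K + L)))))
      where
      r = remainder F s
      t = remainder G s
      r≤K : N r ≤ K
      r≤K = proj₂ (bounded F) s∈
      t≤L : N t ≤ L
      t≤L = proj₂ (bounded G) s∈

    inner-expand : ∀ s → ⟨ f s , g s ⟩ ≈ ⟨ c , d ⟩ + s * slope s
    inner-expand s = begin
      ⟨ f s , g s ⟩
        ≈⟨ inner-cong (expand F s) (expand G s) ⟩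
      ⟨ c ⊕ ι s ⊗ r , d ⊕ ι s ⊗ t ⟩
        ≈⟨ trans (inner-⊕ˡ c (ι s ⊗ r) (d ⊕ ι s ⊗ t)) (+-cong (inner-⊕ʳ c d (ι s ⊗ t)) (inner-⊕ʳ (ι s ⊗ r) d (ι s ⊗ t))) ⟩
      ⟨ c , d ⟩ + ⟨ c , ι s ⊗ t ⟩ + (⟨ ι s ⊗ r , d ⟩ + ⟨ ι s ⊗ r , ι s ⊗ t ⟩)
        ≈⟨ +-cong (+-congˡ (inner-ιʳ s c t))
             (+-cong (inner-ιˡ s r d) (trans (inner-ιˡ s r (ι s ⊗ t)) (*-congˡ (inner-ιʳ s r t)))) ⟩
      ⟨ c , d ⟩ + s * ⟨ c , t ⟩ + (s * ⟨ r , d ⟩ + s * (s * ⟨ r , t ⟩))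
        ≈⟨ solve 5 (λ s cd ct rd rt → cd :+ s :* ct :+ (s :* rd :+ s :* (s :* rt)) :=
             cd :+ s :* (ct :+ rd :+ s :* rt)) refl s ⟨ c , d ⟩ ⟨ c , t ⟩ ⟨ r , d ⟩ ⟨ r , t ⟩ ⟩
      ⟨ c , d ⟩ + s * slope s ∎
      where
      r = remainder F s
      t = remainder G s

    contradict : ¬ (∃[ s ] (Pos s × Pos (1# - s) × Pos (- ⟨ c , d ⟩ - s * B)))
    contradict (s , s>0 , s<1 , sB<-cd) = pos+nonNeg sB<-cd
      (*-nonNeg (pos⇒nonNeg s>0) (slope≤B s∈ (pos⇒nonNeg s>0)))
      (f·g≥0 s∈ ∘ pos-resp (trans
        (solve 4 (λ cd s B X → :- cd :- s :* B :+ s :* (B :- X) := :- (cd :+ s :* X)) refl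
          ⟨ c , d ⟩ s B (slope s))
        (-‿cong (sym (inner-expand s)))))
      where
      s∈ : InUnitInterval s
      s∈ = pos-resp (solve 1 (λ s → s := s :- con (+ 0)) refl s) s>0 , s<1

-- Characteristic polynomials of skew-symmetric matrices

module CharacteristicPolynomial {R : CommutativeRing 0ℓ 0ℓ} (P : PositiveCone R) (CS : ComplexStructure R) where
  open CommutativeRing R hiding (zero)
  open PositiveCone P
  open ComplexStructure CS
  open RingProperties ring
  open IntegerCoefficients R
  open Order P
  open Complex P CS
  open SemiringSum semiring using (sum; sum-cong-≋; sum-remove; ∑-comm; ∑-distrib-+; *-distribˡ-sum; sum-replicate-zero)
  open Determinants C using (det; det-cong; sign; rowExpansion; laplace; laplace-alien)
  private
    module C where
      open CommutativeRing C public
      open SemiringSum (CommutativeRing.semiring C) public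
  open SetoidReasoning setoid

  Skew : ∀ {n} → Matrix Carrier n → Set
  Skew A = ∀ i j → A i j ≈ - A j i

  identity : ∀ {n} → Matrix ℂ n
  identity zero    zero    = 1ᶜ
  identity zero    (suc _) = 0ᶜ
  identity (suc _) zero    = 0ᶜ
  identity (suc i) (suc j) = identity i j

  charMatrix : ∀ {n} → Matrix Carrier n → ℂ → Matrix ℂ n
  charMatrix A z i j = z ⊗ identity i j ⊝ ι (A i j)

  charPoly : ∀ {n} → Matrix Carrier n → ℂ → ℂ
  charPoly A z = det (charMatrix A z)

  identity-punchIn : ∀ {n} (k : Fin (suc n)) i j → identity (punchIn k i) (punchIn k j) ≡ identity i j
  identity-punchIn zero    i       j       = ≡.refl
  identity-punchIn (suc k) zero    zero    = ≡.refl
  identity-punchIn (suc k) zero    (suc j) = ≡.refl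
  identity-punchIn (suc k) (suc i) zero    = ≡.refl
  identity-punchIn (suc k) (suc i) (suc j) = identity-punchIn k i j

  charPoly-principal : ∀ {n} (k : Fin (suc n)) A z →
    det (deleteRowCol k k (charMatrix A z)) ≈ᶜ charPoly (principalSubmatrix k A) z
  charPoly-principal k A z = det-cong λ i j →
    C.reflexive (≡.cong (λ δ → z ⊗ δ ⊝ ι (A (punchIn k i) (punchIn k j))) (identity-punchIn k i j))

  identity-row : ∀ {n} (i : Fin n) (y : Vector ℂ n) → C.sum (λ j → identity i j ⊗ y j) ≈ᶜ y i
  identity-row {suc n} zero y = C.trans (C.+-cong (C.*-identityˡ (y zero))
    (C.trans (C.sum-cong-≋ (λ j → C.zeroˡ (y (suc j)))) (C.sum-replicate-zero n))) (C.+-identityʳ _)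
  identity-row {suc n} (suc i) y = C.trans (C.+-cong (C.zeroˡ (y zero)) (identity-row i (y ∘ suc))) (C.+-identityˡ _)

  inner-sum : ∀ {n} z (v : Vector ℂ n) → ⟨ z , C.sum v ⟩ ≈ sum (λ j → ⟨ z , v j ⟩)
  inner-sum {zero}  z v = inner-0ʳ z
  inner-sum {suc n} z v = trans (inner-⊕ʳ z (v zero) (C.sum (v ∘ suc))) (+-congˡ (inner-sum z (v ∘ suc)))

  -- The contribution of `A` is kept on the left: it cancels only after summation over `i`, by
  -- `skew-form-zero`.
  inner-charMatrix : ∀ {n} (A : Matrix Carrier n) z (y : Vector ℂ n) i →
    ⟨ y i , C.sum (λ j → charMatrix A z i j ⊗ y j) ⟩ + sum (λ j → A i j * ⟨ y i , y j ⟩) ≈ re z * N (y i)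
  inner-charMatrix A z y i = begin
    ⟨ y i , C.sum (λ j → charMatrix A z i j ⊗ y j) ⟩ + sum (λ j → A i j * ⟨ y i , y j ⟩)
      ≈⟨ +-congʳ (inner-sum (y i) (λ j → charMatrix A z i j ⊗ y j)) ⟩
    sum (λ j → ⟨ y i , charMatrix A z i j ⊗ y j ⟩) + sum (λ j → A i j * ⟨ y i , y j ⟩)
      ≈⟨ ∑-distrib-+ (λ j → ⟨ y i , charMatrix A z i j ⊗ y j ⟩) (λ j → A i j * ⟨ y i , y j ⟩) ⟨
    sum (λ j → ⟨ y i , charMatrix A z i j ⊗ y j ⟩ + A i j * ⟨ y i , y j ⟩)
      ≈⟨ sum-cong-≋ (λ j → trans (+-congˡ (sym (inner-ιʳ (A i j) (y i) (y j))))
           (trans (sym (inner-⊕ʳ (y i) (charMatrix A z i j ⊗ y j) (ι (A i j) ⊗ y j)))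
                  (inner-cong C.refl (cancel (z ⊗ identity i j) (ι (A i j)) (y j))))) ⟩
    sum (λ j → ⟨ y i , (z ⊗ identity i j) ⊗ y j ⟩)
      ≈⟨ inner-sum (y i) (λ j → (z ⊗ identity i j) ⊗ y j) ⟨
    ⟨ y i , C.sum (λ j → (z ⊗ identity i j) ⊗ y j) ⟩
      ≈⟨ inner-cong C.refl (C.sum-cong-≋ (λ j → C.*-assoc z (identity i j) (y j))) ⟩
    ⟨ y i , C.sum (λ j → z ⊗ (identity i j ⊗ y j)) ⟩
      ≈⟨ inner-cong C.refl (C.*-distribˡ-sum z (λ j → identity i j ⊗ y j)) ⟨
    ⟨ y i , z ⊗ C.sum (λ j → identity i j ⊗ y j) ⟩
      ≈⟨ inner-cong C.refl (C.*-congˡ (identity-row i y)) ⟩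
    ⟨ y i , z ⊗ y i ⟩
      ≈⟨ inner-self-⊗ z (y i) ⟩
    re z * N (y i) ∎
    where
    cancel : ∀ a b w → (a ⊝ b) ⊗ w ⊕ b ⊗ w ≈ᶜ a ⊗ w
    cancel a b w = C.trans (C.sym (C.distribʳ w (a ⊝ b) b)) (C.*-congʳ
      (C.trans (C.+-assoc a (⊖ b) b) (C.trans (C.+-congˡ (C.-‿inverseˡ b)) (C.+-identityʳ a))))

  double-zero : ∀ {x} → x + x ≈ 0# → x ≈ 0#
  double-zero {x} 2x≈0 = tight
    (λ x>0 → pos⇒≉0 (+-pos x>0 x>0) 2x≈0)
    (double-cancel-nonNeg (nonNeg-resp (sym 2x≈0) nonNeg-0))

  -- The coefficients are antisymmetric and the inner products symmetric, so transposing the double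
  -- sum changes its sign.
  skew-form-zero : ∀ {n} {A : Matrix Carrier n} → Skew A → (y : Vector ℂ n) →
    sum (λ i → sum (λ j → A i j * ⟨ y i , y j ⟩)) ≈ 0#
  skew-form-zero {n} {A} skew y = double-zero (begin
    sum (λ i → sum (λ j → t i j)) + sum (λ i → sum (λ j → t i j))
      ≈⟨ +-congˡ (∑-comm t) ⟩
    sum (λ i → sum (λ j → t i j)) + sum (λ i → sum (λ j → t j i))
      ≈⟨ ∑-distrib-+ (λ i → sum (t i)) (λ i → sum (λ j → t j i)) ⟨
    sum (λ i → sum (λ j → t i j) + sum (λ j → t j i))
      ≈⟨ sum-cong-≋ (λ i → sym (∑-distrib-+ (t i) (λ j → t j i))) ⟩
    sum (λ i → sum (λ j → t i j + t j i))
      ≈⟨ sum-cong-≋ (λ i → trans (sum-cong-≋ (λ j → cancel i j)) (sum-replicate-zero n)) ⟩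
    sum {n} (λ i → 0#)
      ≈⟨ sum-replicate-zero n ⟩
    0# ∎)
    where
    t : Fin n → Fin n → Carrier
    t i j = A i j * ⟨ y i , y j ⟩
    cancel : ∀ i j → t i j + t j i ≈ 0#
    cancel i j = trans (+-cong (*-congʳ (skew i j)) (*-congˡ (inner-sym (y j) (y i))))
      (solve 2 (λ a b → :- a :* b :+ a :* b := con (+ 0)) refl (A j i) ⟨ y i , y j ⟩)

  N-sign : ∀ {n} (k : Fin n) → N (sign k) ≈ 1#
  N-sign zero    = N-1
  N-sign (suc k) = trans (N-⊗ (⊖ 1ᶜ) (sign k)) (trans (*-cong N-⊖1 (N-sign k)) (*-identityʳ 1#))
    where
    N-⊖1 : N (⊖ 1ᶜ) ≈ 1#
    N-⊖1 = trans (+-cong (*-cong (re-⊖ 1ᶜ) (re-⊖ 1ᶜ)) (*-cong (im-⊖ 1ᶜ) (im-⊖ 1ᶜ)))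
      (trans (solve 2 (λ a b → :- a :* :- a :+ :- b :* :- b := a :* a :+ b :* b) refl (re 1ᶜ) (im 1ᶜ)) N-1)

  -- Applied to y the k-th column of the adjugate of z I - A, up to signs; both sides are the
  -- real part of y* (z I - A) y.
  inner-column : ∀ {n} {A : Matrix Carrier (suc n)} → Skew A → ∀ k z (y : Vector ℂ (suc n)) {σ p q} →
    N σ ≈ 1# → y k ≈ᶜ σ ⊗ q →
    C.sum (λ j → charMatrix A z k j ⊗ y j) ≈ᶜ σ ⊗ p →
    (∀ i → i ≢ k → C.sum (λ j → charMatrix A z i j ⊗ y j) ≈ᶜ 0ᶜ) →
    ⟨ q , p ⟩ ≈ re z * (N q + sum (λ l → N (y (punchIn k l))))
  inner-column {n} {A} skew k z y {σ} {p} {q} Nσ≈1 y-k row-k row-i = begin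
    ⟨ q , p ⟩
      ≈⟨ *-identityˡ _ ⟨
    1# * ⟨ q , p ⟩
      ≈⟨ *-congʳ Nσ≈1 ⟨
    N σ * ⟨ q , p ⟩
      ≈⟨ inner-⊗ σ q p ⟨
    ⟨ σ ⊗ q , σ ⊗ p ⟩
      ≈⟨ inner-cong y-k row-k ⟨
    t k
      ≈⟨ +-identityʳ _ ⟨
    t k + 0#
      ≈⟨ +-congˡ (trans (sum-cong-≋ (λ l → trans
           (inner-cong C.refl (row-i (punchIn k l) (Fin.punchInᵢ≢i k l))) (inner-0ʳ (y (punchIn k l)))))
           (sum-replicate-zero n)) ⟨
    t k + sum (λ l → t (punchIn k l))
      ≈⟨ sum-remove {i = k} t ⟨
    sum t
      ≈⟨ +-identityʳ _ ⟨
    sum t + 0#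
      ≈⟨ +-congˡ (skew-form-zero skew y) ⟨
    sum t + sum (λ i → sum (λ j → A i j * ⟨ y i , y j ⟩))
      ≈⟨ ∑-distrib-+ t (λ i → sum (λ j → A i j * ⟨ y i , y j ⟩)) ⟨
    sum (λ i → t i + sum (λ j → A i j * ⟨ y i , y j ⟩))
      ≈⟨ sum-cong-≋ (λ i → inner-charMatrix A z y i) ⟩
    sum (λ i → re z * N (y i))
      ≈⟨ *-distribˡ-sum (re z) (λ i → N (y i)) ⟨
    re z * sum (λ i → N (y i))
      ≈⟨ *-congˡ (sum-remove {i = k} (λ i → N (y i))) ⟩
    re z * (N (y k) + sum (λ l → N (y (punchIn k l))))
      ≈⟨ *-congˡ (+-congʳ (trans (N-cong y-k) (trans (N-⊗ σ q)
           (trans (*-congʳ Nσ≈1) (*-identityˡ _))))) ⟩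
    re z * (N q + sum (λ l → N (y (punchIn k l)))) ∎
    where
    t : Vector Carrier (suc n)
    t i = ⟨ y i , C.sum (λ j → charMatrix A z i j ⊗ y j) ⟩

  -- |q|² is split off from |y|² because it is used in two ways: `N q > 0` excludes zeros of p off
  -- the axis, and discarding `r` gives the half-plane inequality.
  inner-charPoly : ∀ {n} {A : Matrix Carrier (suc n)} → Skew A → ∀ k z →
    ∃[ r ] (NonNeg r × ⟨ charPoly (principalSubmatrix k A) z , charPoly A z ⟩ ≈
                       re z * (N (charPoly (principalSubmatrix k A) z) + r))
  inner-charPoly {n} {A} skew k z =
    sum (λ l → N (y (punchIn k l))) , sum-nonNeg (λ l → N-nonNeg (y (punchIn k l))) ,
    inner-column {A = A} skew k z y (N-sign k) (C.*-congˡ (charPoly-principal k A z))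
      (C.trans (row k) (laplace k M))
      (λ i i≢k → C.trans (row i) (laplace-alien k i M (i≢k ∘ ≡.sym)))
    where
    M : Matrix ℂ (suc n)
    M = charMatrix A z
    -- The cofactors along row `k` without their common factor `sign k`. That factor reappears as σ
    -- in `inner-column`, where only its modulus 1 matters.
    y : Vector ℂ (suc n)
    y j = sign j ⊗ det (deleteRowCol k j M)
    *-left-comm : ∀ a b c → a ⊗ (b ⊗ c) ≈ᶜ b ⊗ (a ⊗ c)
    *-left-comm a b c = C.trans (C.sym (C.*-assoc a b c)) (C.trans (C.*-congʳ (C.*-comm a b)) (C.*-assoc b a c))
    row : ∀ i → C.sum (λ j → M i j ⊗ y j) ≈ᶜ rowExpansion k M (M i)
    row i = C.sum-cong-≋ λ j → *-left-comm (M i j) (sign j) (det (deleteRowCol k j M))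

  numerator≉0 : ∀ {z p q r} → ¬ (re z ≈ 0#) → ¬ (q ≈ᶜ 0ᶜ) → NonNeg r → ⟨ q , p ⟩ ≈ re z * (N q + r) → ¬ (p ≈ᶜ 0ᶜ)
  numerator≉0 {z} {p} {q} {r} re≉0 q≉0 r≥0 qp≈ p≈0 =
    N-pos q≉0 λ Nq>0 → pos+nonNeg Nq>0 r≥0 λ S>0 → trichotomy (re z) λ
      { (inj₁ re>0)        → pos⇒≉0 (*-pos re>0 S>0) zS≈0
      ; (inj₂ (inj₁ re≈0)) → re≉0 re≈0
      ; (inj₂ (inj₂ re<0)) → pos⇒≉0 (*-pos re<0 S>0)
          (trans (sym (-‿distribˡ-* _ _)) (trans (-‿cong zS≈0) -0#≈0#)) }
    where
    zS≈0 : re z * (N q + r) ≈ 0#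
    zS≈0 = trans (sym qp≈) (trans (inner-cong C.refl p≈0) (inner-0ʳ q))

  -- A zero of p would force Re z |y|² = 0. But q is, up to sign, an entry of y, and it does not
  -- vanish at `z` by the induction hypothesis; the empty determinant 1 starts the induction.
  charPoly≉0 : ∀ {n} {A : Matrix Carrier n} → Skew A → ∀ {z} → ¬ (re z ≈ 0#) → ¬ (charPoly A z ≈ᶜ 0ᶜ)
  charPoly≉0 {zero}      skew     re≉0 1≈0 =
    pos⇒≉0 pos-1 (trans (sym re-1) (trans (re-cong 1≈0) re-0))
  charPoly≉0 {suc n} {A} skew {z} re≉0 =
    let (r , r≥0 , qp≈) = inner-charPoly {A = A} skew zero z in
    numerator≉0 re≉0 (charPoly≉0 {A = principalSubmatrix zero A} (λ i j → skew (suc i) (suc j)) re≉0) r≥0 qp≈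

  root-imaginary : ∀ {n} {A : Matrix Carrier n} → Skew A → ∀ {z} → charPoly A z ≈ᶜ 0ᶜ → re z ≈ 0#
  root-imaginary {A = A} skew {z} pz≈0 = tight
    (λ re>0 → charPoly≉0 {A = A} skew {z} (pos⇒≉0 re>0) pz≈0)
    (λ re<0 → charPoly≉0 {A = A} skew {z} (λ re≈0 → pos⇒≉0 re<0 (trans (-‿cong re≈0) -0#≈0#)) pz≈0)

-- Positions after the deletion of an index

punchIn-≥ : ∀ {n} (i : Fin (suc n)) j → toℕ j ℕ.≤ toℕ (punchIn i j)
punchIn-≥ zero    j       = ℕ.n≤1+n _
punchIn-≥ (suc i) zero    = ℕ.z≤n
punchIn-≥ (suc i) (suc j) = ℕ.s≤s (punchIn-≥ i j)

punchIn-≤suc : ∀ {n} (i : Fin (suc n)) j → toℕ (punchIn i j) ℕ.≤ suc (toℕ j)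
punchIn-≤suc zero    j       = ℕ.≤-refl
punchIn-≤suc (suc i) zero    = ℕ.z≤n
punchIn-≤suc (suc i) (suc j) = ℕ.s≤s (punchIn-≤suc i j)

toℕ-punchIn-above : ∀ {n} {i : Fin (suc n)} {j} → toℕ i ℕ.≤ toℕ j → toℕ (punchIn i j) ≡ suc (toℕ j)
toℕ-punchIn-above {i = zero}              i≤j         = ≡.refl
toℕ-punchIn-above {i = suc i} {j = suc j} (ℕ.s≤s i≤j) = ≡.cong suc (toℕ-punchIn-above i≤j)

toℕ-punchIn-below : ∀ {n} {i : Fin (suc n)} {j} → toℕ j ℕ.< toℕ i → toℕ (punchIn i j) ≡ toℕ j
toℕ-punchIn-below {i = suc i} {j = zero}  j<i         = ≡.refl
toℕ-punchIn-below {i = suc i} {j = suc j} (ℕ.s≤s j<i) = ≡.cong suc (toℕ-punchIn-below j<i)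

-- The enumerations that omit `inject₁ i` and `suc i` differ only at position `i`, so the products
-- at the two ends of a gap can be compared factor by factor.
punchIn-adjacent : ∀ {n} {i l : Fin n} → l ≢ i → punchIn (inject₁ i) l ≡ punchIn (suc i) l
punchIn-adjacent {i = zero}  {zero}  l≢i = contradiction ≡.refl l≢i
punchIn-adjacent {i = zero}  {suc l} l≢i = ≡.refl
punchIn-adjacent {i = suc i} {zero}  l≢i = ≡.refl
punchIn-adjacent {i = suc i} {suc l} l≢i = ≡.cong suc (punchIn-adjacent (l≢i ∘ ≡.cong suc))

-- A strictly increasing map gains at least one at each step. Counting up from the first index gives
-- `i ≤ φ i`, counting down from the last gives `φ i ≤ i`.
strictlyMonotone⇒id : ∀ {m} (φ : Fin m → Fin m) → (∀ {i j} → i Fin.< j → φ i Fin.< φ j) → ∀ i → φ i ≡ i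
strictlyMonotone⇒id {suc m} φ φ-mono i = Fin.toℕ-injective (ℕ.≤-antisym
  (>-weakInduction (λ i → φ i Fin.≤ i) (Fin.≤fromℕ _) step-down i)
  (<-weakInduction (λ i → i Fin.≤ φ i) ℕ.z≤n step-up i))
  where
  inject₁<suc : ∀ i → inject₁ i Fin.< suc i
  inject₁<suc i = ℕ.s≤s (ℕ.≤-reflexive (Fin.toℕ-inject₁ i))
  step-up : ∀ i → inject₁ i Fin.≤ φ (inject₁ i) → suc i Fin.≤ φ (suc i)
  step-up i i≤φi = ℕ.≤-trans (ℕ.s≤s (≡.subst (ℕ._≤ toℕ (φ (inject₁ i))) (Fin.toℕ-inject₁ i) i≤φi)) (φ-mono (inject₁<suc i))
  step-down : ∀ i → φ (suc i) Fin.≤ suc i → φ (inject₁ i) Fin.≤ inject₁ i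
  step-down i φi≤i = ≡.subst (toℕ (φ (inject₁ i)) ℕ.≤_) (≡.sym (Fin.toℕ-inject₁ i))
    (ℕ.≤-pred (ℕ.≤-trans (φ-mono (inject₁<suc i)) φi≤i))

-- Interlacing of real sequences

module Interlacing {R : CommutativeRing 0ℓ 0ℓ} (P : PositiveCone R) where
  open CommutativeRing R hiding (zero)
  open PositiveCone P
  open IntegerCoefficients R
  open Order P

  Sorted : ∀ {n} → Vector Carrier n → Set
  Sorted a = ∀ {i j} → i Fin.≤ j → a i ≤ a j

  Interlace : ∀ {m} → Vector Carrier (suc m) → Vector Carrier m → Set
  Interlace a b = ∀ i → a (inject₁ i) ≤ b i × b i ≤ a (suc i)

  module Insert {m} {a : Vector Carrier (suc (suc m))} {b : Vector Carrier (suc m)}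
    (a↗ : Sorted a) (b↗ : Sorted b) (i : Fin (suc (suc m))) (j : Fin (suc m)) (ai≈bj : a i ≈ b j)
    (inter : Interlace (a ∘ punchIn i) (b ∘ punchIn j)) where

    -- Putting the common value back. For k < j the entry `b k` keeps its position in the shortened
    -- sequence, while the deletion can only have raised the k-th `a`. For j ≤ k ≤ i the common
    -- value separates the two entries. For k > i and k ≥ j the shortened sequences are compared at
    -- k - 1. `upper` is the mirror image, with `a` shifted by one.
    lower : ∀ k → a (inject₁ k) ≤ b k
    lower k with toℕ k ℕ.<? toℕ j | toℕ k ℕ.≤? toℕ i
    ... | yes k<j | _ = ≤-trans
      (≤-trans (a↗ (ℕ.≤-trans (ℕ.≤-reflexive inject₁k≡) (punchIn-≥ i (inject₁ k′)))) (proj₁ (inter k′)))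
      (b↗ (ℕ.≤-reflexive (≡.trans (toℕ-punchIn-below (≡.subst (ℕ._< _) (≡.sym k′≡k) k<j)) k′≡k)))
      where
      k<m : toℕ k ℕ.< m
      k<m = ℕ.≤-trans k<j (ℕ.≤-pred (Fin.toℕ<n j))
      k′ : Fin m
      k′ = Fin.fromℕ< k<m
      k′≡k : toℕ k′ ≡ toℕ k
      k′≡k = Fin.toℕ-fromℕ< k<m
      inject₁k≡ : toℕ (inject₁ k) ≡ toℕ (inject₁ k′)
      inject₁k≡ = ≡.trans (Fin.toℕ-inject₁ k) (≡.sym (≡.trans (Fin.toℕ-inject₁ k′) k′≡k))
    ... | no k≮j | yes k≤i = ≤-trans
      (a↗ (≡.subst (ℕ._≤ _) (≡.sym (Fin.toℕ-inject₁ k)) k≤i))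
      (≤-trans (≤-reflexive ai≈bj) (b↗ (ℕ.≮⇒≥ k≮j)))
    lower zero | no _ | no 0≰i = contradiction ℕ.z≤n 0≰i
    lower (suc k) | no _ | no k≰i = ≤-trans
      (≤-trans (a↗ (ℕ.≤-reflexive (≡.sym (toℕ-punchIn-above i≤k)))) (proj₁ (inter k)))
      (b↗ (punchIn-≤suc j k))
      where
      i≤k : toℕ i ℕ.≤ toℕ (inject₁ k)
      i≤k = ≡.subst (_ ℕ.≤_) (≡.sym (Fin.toℕ-inject₁ k)) (ℕ.≤-pred (ℕ.≰⇒> k≰i))

    upper : ∀ k → b k ≤ a (suc k)
    upper k with toℕ k ℕ.≤? toℕ j | toℕ i ℕ.≤? suc (toℕ k)
    ... | yes k≤j | yes i≤1+k = ≤-trans (b↗ k≤j) (≤-trans (≤-reflexive (sym ai≈bj)) (a↗ i≤1+k))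
    ... | yes k≤j | no i≰1+k = ≤-trans
      (≤-trans (b↗ (ℕ.≤-trans (ℕ.≤-reflexive (≡.sym k′≡k)) (punchIn-≥ j k′))) (proj₂ (inter k′)))
      (a↗ (ℕ.≤-reflexive (≡.trans (toℕ-punchIn-below 1+k′<i) (≡.cong suc k′≡k))))
      where
      1+k<i : suc (toℕ k) ℕ.< toℕ i
      1+k<i = ℕ.≰⇒> i≰1+k
      k<m : toℕ k ℕ.< m
      k<m = ℕ.≤-pred (ℕ.≤-trans 1+k<i (ℕ.≤-pred (Fin.toℕ<n i)))
      k′ : Fin m
      k′ = Fin.fromℕ< k<m
      k′≡k : toℕ k′ ≡ toℕ k
      k′≡k = Fin.toℕ-fromℕ< k<m
      1+k′<i : suc (toℕ k′) ℕ.< toℕ i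
      1+k′<i = ≡.subst (λ l → suc l ℕ.< toℕ i) (≡.sym k′≡k) 1+k<i
    upper zero | no 0≰j | _ = contradiction ℕ.z≤n 0≰j
    upper (suc k) | no k≰j | _ = ≤-trans
      (≤-trans (b↗ (ℕ.≤-reflexive (≡.sym (toℕ-punchIn-above (ℕ.≤-pred (ℕ.≰⇒> k≰j)))))) (proj₂ (inter k)))
      (a↗ (punchIn-≤suc i (suc k)))

  -- For the real monic polynomials P and Q with zeros `a` and `b`, the product in `residue>0` is
  -- P′(a i) Q(a i). It has the sign of Q(a i) / P′(a i), the residue of Q / P at `a i`.
  module Gaps {m} {a : Vector Carrier (suc m)} {b : Vector Carrier m}
    (a↗ : Sorted a) (b↗ : Sorted b) (a≉b : ∀ i j → ¬ (a i ≈ b j))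
    (residue>0 : ∀ i → Pos (product (λ l → (a i - a (punchIn i l)) * (a i - b l)))) where

    -- Simplicity of the zeros comes with the residues: a repeated `a i` would put a zero factor
    -- into its own product.
    a-punchIn : ∀ i l → ¬ (a i ≈ a (punchIn i l))
    a-punchIn i l eq = pos⇒≉0 (residue>0 i) (product-zero l
      (trans (*-congʳ (trans (+-congˡ (-‿cong (sym eq))) (-‿inverseʳ (a i)))) (zeroˡ _)))

    -- With no b l in the gap, the product of the residues at its two ends has exactly one
    -- negative factor, at l = i.
    gap-occupied : ∀ i → ¬ ¬ (∃[ l ] (a (inject₁ i) < b l × b l < a (suc i)))
    gap-occupied i empty = ¬¬-finite factor-pos λ other>0 → factor-neg λ i<0 →
      pos⇒nonNeg (*-pos (residue>0 (inject₁ i)) (residue>0 (suc i)))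
        (pos-resp (-‿cong (product-distrib-* left right)) (product-neg i i<0 other>0))
      where
      x y : Carrier
      x = a (inject₁ i)
      y = a (suc i)
      left right : Vector Carrier m
      left  l = (x - a (punchIn (inject₁ i) l)) * (x - b l)
      right l = (y - a (punchIn (suc i) l)) * (y - b l)

      inject₁≤suc : inject₁ i Fin.≤ suc i
      inject₁≤suc = ≡.subst (ℕ._≤ suc (toℕ i)) (≡.sym (Fin.toℕ-inject₁ i)) (ℕ.n≤1+n _)

      x≤y : x ≤ y
      x≤y = a↗ inject₁≤suc

      b-pos : ∀ l → ¬ ¬ Pos ((x - b l) * (y - b l))
      b-pos l = outside-interval x≤y (λ between → empty (l , between)) (a≉b _ l) (a≉b _ l)

      a∉gap : ∀ t → ¬ (x < a t × a t < y)
      a∉gap t (x<t , t<y) with toℕ t ℕ.≤? toℕ i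
      ... | yes t≤i = <⇒≱ x<t (a↗ (≡.subst (_ ℕ.≤_) (≡.sym (Fin.toℕ-inject₁ i)) t≤i))
      ... | no  t≰i = <⇒≱ t<y (a↗ (ℕ.≰⇒> t≰i))

      a-pos : ∀ l → l ≢ i → ¬ ¬ Pos ((x - a (punchIn (suc i) l)) * (y - a (punchIn (suc i) l)))
      a-pos l l≢i = outside-interval x≤y (a∉gap _)
        (≡.subst (λ t → ¬ (x ≈ a t)) (punchIn-adjacent l≢i) (a-punchIn (inject₁ i) l))
        (a-punchIn (suc i) l)

      regroup : ∀ p q r s → (p * q) * (r * s) ≈ (p * r) * (q * s)
      regroup = solve 4 (λ p q r s → (p :* q) :* (r :* s) := (p :* r) :* (q :* s)) refl

      -- The condition `l ≢ i` stands under the double negation so that `¬¬-finite` can range over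
      -- all `l`.
      factor-pos : ∀ l → ¬ ¬ (l ≢ i → Pos (left l * right l))
      factor-pos l k with l Fin.≟ i
      ... | yes l≡i = k λ l≢i → contradiction l≡i l≢i
      ... | no  l≢i = a-pos l l≢i λ A>0 → b-pos l λ B>0 → k λ _ → pos-resp
        (trans (regroup _ _ _ _)
          (*-congʳ (*-congʳ (+-congˡ (-‿cong (reflexive (≡.cong a (≡.sym (punchIn-adjacent l≢i)))))))))
        (*-pos A>0 B>0)

      -- At `l = i` each end of the gap meets the other one, so the `a`-factors multiply to -(y -
      -- x)²; the `b`-factors have a positive product. Equality of `x` and `y` is excluded by
      -- `a-punchIn`.
      factor-neg : ¬ ¬ Pos (- (left i * right i))
      factor-neg k = b-pos i λ B>0 → nonNeg-cases x≤y λ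
        { (inj₁ x<y) → k (pos-resp
            (trans (solve 4 (λ x y p q → ((y :- x) :* (y :- x)) :* (p :* q) :=
                              :- (((x :- y) :* p) :* ((y :- x) :* q))) refl x y (x - b i) (y - b i))
              (-‿cong (*-cong
                (*-congʳ (+-congˡ (-‿cong (reflexive (≡.cong a (≡.sym (punchIn-inject₁ (ℕ.≤-refl {toℕ i}))))))))
                (*-congʳ (+-congˡ (-‿cong (reflexive (≡.cong a (≡.sym (punchIn-suc (ℕ.≤-refl {toℕ i})))))))))))
            (*-pos (*-pos x<y x<y) B>0))
        ; (inj₂ y≈x) → a-punchIn (inject₁ i) i
            (≡.subst (λ t → x ≈ a t) (≡.sym (punchIn-inject₁ (ℕ.≤-refl {toℕ i})))
              (sym (trans (solve 2 (λ x y → y := (y :- x) :+ x) refl x y) (trans (+-congʳ y≈x) (+-identityˡ x))))) }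

    interlace : ¬ ¬ Interlace a b
    interlace k = ¬¬-finite gap-occupied λ occupied →
      let φ : Fin m → Fin m
          φ i = proj₁ (occupied i)
          -- Otherwise b (φ j) ≤ b (φ i) < a (i + 1) ≤ a j < b (φ j). The choice of a `b` in each
          -- gap is thus strictly increasing, hence the identity, and this replaces counting.
          φ-mono : ∀ {i j} → i Fin.< j → φ i Fin.< φ j
          φ-mono {i} {j} i<j = ℕ.≰⇒> λ φj≤φi →
            <⇒≱ (proj₁ (proj₂ (occupied j)))
              (≤-trans (b↗ φj≤φi) (≤-trans (<⇒≤ (proj₂ (proj₂ (occupied i))))
                (a↗ (≡.subst (_ ℕ.≤_) (≡.sym (Fin.toℕ-inject₁ j)) i<j))))
      in k λ i → ≡.subst (λ l → a (inject₁ i) ≤ b l × b l ≤ a (suc i))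
           (strictlyMonotone⇒id φ φ-mono i)
           (<⇒≤ (proj₁ (proj₂ (occupied i))) , <⇒≤ (proj₂ (proj₂ (occupied i))))

-- From the half-plane inequality to interlacing spectra

module Spectra {R : CommutativeRing 0ℓ 0ℓ} (P : PositiveCone R) (CS : ComplexStructure R) where
  open CommutativeRing R hiding (zero)
  open PositiveCone P
  open ComplexStructure CS
  open RingProperties ring
  open IntegerCoefficients R
  open Order P
  open Complex P CS
  open CharacteristicPolynomial P CS
  open Interlacing P
  private
    module C where
      open CommutativeRing C public
      open FirstOrderExpansions C public
  open SetoidReasoning setoid

  Imaginary : ∀ {n} → Vector ℂ n → Set
  Imaginary v = ∀ l → re (v l) ≈ 0#

  monic : ∀ {n} → Vector ℂ n → ℂ → ℂ
  monic λs z = ∏ (λ l → z ⊝ λs l)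

  -- Re (monic λs z / monic μs z) ≥ re z, cleared of its denominator.
  HalfPlane : ∀ {m n} → Vector ℂ m → Vector ℂ n → Set
  HalfPlane λs μs = ∀ z → Pos (re z) → re z * N (monic μs z) ≤ ⟨ monic λs z , monic μs z ⟩

  *-cancelˡ-≤ : ∀ {s x y} → Pos s → s * x ≤ s * y → x ≤ y
  *-cancelˡ-≤ {s} {x} {y} s>0 sx≤sy = *-cancel-nonNeg s>0
    (nonNeg-resp (solve 3 (λ s x y → s :* y :- s :* x := s :* (y :- x)) refl s x y) sx≤sy)

  re-shift : ∀ z {w} → re w ≈ 0# → re (z ⊝ w) ≈ re z
  re-shift z {w} rew≈0 = trans (re-⊝ z w) (trans (+-congˡ (trans (-‿cong rew≈0) -0#≈0#)) (+-identityʳ _))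

  monic-remove : ∀ {n} (λs : Vector ℂ (suc n)) i z → monic λs z ≈ᶜ (z ⊝ λs i) ⊗ monic (λs ∘ punchIn i) z
  monic-remove λs i z = ∏-remove {i = i} (λ l → z ⊝ λs l)

  -- The common factor `c = z ⊝ μs j` multiplies both sides by `N c`. This is positive on the right
  -- half-plane, because `μs j` is imaginary and so `c` has the same real part as `z`.
  halfPlane-cancel : ∀ {m n} {λs : Vector ℂ (suc m)} {μs : Vector ℂ (suc n)} i j → λs i ≈ᶜ μs j →
    re (μs j) ≈ 0# → HalfPlane λs μs → HalfPlane (λs ∘ punchIn i) (μs ∘ punchIn j)
  halfPlane-cancel {λs = λs} {μs} i j λi≈μj μj-imaginary half z re>0 pf =
    re-pos⇒N-pos {z ⊝ μs j} (pos-resp (sym (re-shift z μj-imaginary)) re>0) λ Nc>0 →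
    *-cancelˡ-≤ Nc>0 (≤-trans (≤-reflexive lhs) (≤-trans (half z re>0) (≤-reflexive rhs))) pf
    where
    c p q : ℂ
    c = z ⊝ μs j
    p = monic (λs ∘ punchIn i) z
    q = monic (μs ∘ punchIn j) z
    q-eq : monic μs z ≈ᶜ c ⊗ q
    q-eq = monic-remove μs j z
    p-eq : monic λs z ≈ᶜ c ⊗ p
    p-eq = C.trans (monic-remove λs i z) (C.*-congʳ (C.+-congˡ (C.-‿cong λi≈μj)))
    lhs : N c * (re z * N q) ≈ re z * N (monic μs z)
    lhs = trans (solve 3 (λ a b d → a :* (b :* d) := b :* (a :* d)) refl (N c) (re z) (N q))
      (*-congˡ (trans (sym (N-⊗ c q)) (N-cong (C.sym q-eq))))
    rhs : ⟨ monic λs z , monic μs z ⟩ ≈ N c * ⟨ p , q ⟩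
    rhs = trans (inner-cong p-eq q-eq) (inner-⊗ c p q)

  -- The half-plane inequality at z = λs j + s, divided by s, as s → 0⁺.
  module Residue {m} {λs : Vector ℂ (suc m)} {μs : Vector ℂ m} (λ-im : Imaginary λs) (μ-im : Imaginary μs)
    (half : HalfPlane λs μs) (j : Fin (suc m)) where

    private
      c d : Vector ℂ m
      c l = λs j ⊝ λs (punchIn j l)
      d l = λs j ⊝ μs l

      c-im : Imaginary c
      c-im l = trans (re-shift (λs j) (λ-im (punchIn j l))) (λ-im j)

      d-im : Imaginary d
      d-im l = trans (re-shift (λs j) (μ-im l)) (λ-im j)

      -- At `z = λs j ⊕ ι s` the factor of `λs j` is exactly `ι s`, so `s` divides both sides. The
      -- quotient is written as one inner product of `p ⊝ q` with `q`, the form that `inner-limit`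
      -- accepts.
      inner-nonNeg : ∀ {s} → InUnitInterval s →
        NonNeg ⟨ ∏ (λ l → c l ⊕ ι s) ⊝ ∏ (λ l → d l ⊕ ι s) , ∏ (λ l → d l ⊕ ι s) ⟩
      inner-nonNeg {s} (s>0 , _) = nonNeg-resp (sym (inner-⊝ˡ p q q))
        (*-cancelˡ-≤ (pos-resp (solve 1 (λ s → s :- con (+ 0) := s) refl s) s>0)
          (≤-trans (≤-reflexive (*-cong (sym re-z) (N-cong (C.sym q-eq))))
            (≤-trans (half z (pos-resp (trans (solve 1 (λ s → s :- con (+ 0) := s) refl s) (sym re-z)) s>0))
              (≤-reflexive (trans (inner-cong p-eq q-eq) (inner-ιˡ s p q))))))
        where
        z p q : ℂ
        z = λs j ⊕ ι s
        p = ∏ (λ l → c l ⊕ ι s)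
        q = ∏ (λ l → d l ⊕ ι s)
        re-z : re z ≈ s
        re-z = trans (re-⊕ (λs j) (ι s)) (trans (+-cong (λ-im j) (re-+i s 0#)) (+-identityˡ s))
        q-eq : monic μs z ≈ᶜ q
        q-eq = ∏-cong λ l → C.shift-difference (λs j) (ι s) (μs l)
        p-eq : monic λs z ≈ᶜ ι s ⊗ p
        p-eq = C.trans (monic-remove λs j z) (C.*-cong (C.shift-self (λs j) (ι s))
          (∏-cong λ l → C.shift-difference (λs j) (ι s) (λs (punchIn j l))))

      limit : NonNeg (⟨ ∏ c , ∏ d ⟩ - N (∏ d))
      limit = nonNeg-resp (inner-⊝ˡ (∏ c) (∏ d) (∏ d))
        (inner-limit (expansion-⊝ (expansion-∏ c) (expansion-∏ d)) (expansion-∏ d) inner-nonNeg)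

    residue-pos : (∀ l → ¬ (λs j ≈ᶜ μs l)) →
      ¬ ¬ Pos (product (λ l → (im (λs j) - im (λs (punchIn j l))) * (im (λs j) - im (μs l))))
    residue-pos λj∉μs k = ¬¬-finite (λ l → N-pos (d≉0 l)) λ Nd>0 →
      pos+nonNeg (N-∏-pos Nd>0) limit λ cd>0 → k (pos-resp eq cd>0)
      where
      d≉0 : ∀ l → ¬ (d l ≈ᶜ 0ᶜ)
      d≉0 l dl≈0 = λj∉μs l (C.trans (C.sym (C.+-identityʳ (λs j)))
        (C.trans (C.+-congˡ (C.sym (C.-‿inverseˡ (μs l))))
          (C.trans (C.sym (C.+-assoc (λs j) (⊖ μs l) (μs l))) (C.trans (C.+-congʳ dl≈0) (C.+-identityˡ (μs l))))))
      eq : N (∏ d) + (⟨ ∏ c , ∏ d ⟩ - N (∏ d)) ≈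
        product (λ l → (im (λs j) - im (λs (punchIn j l))) * (im (λs j) - im (μs l)))
      eq = begin
        N (∏ d) + (⟨ ∏ c , ∏ d ⟩ - N (∏ d))
          ≈⟨ solve 2 (λ a b → a :+ (b :- a) := b) refl (N (∏ d)) ⟨ ∏ c , ∏ d ⟩ ⟩
        ⟨ ∏ c , ∏ d ⟩
          ≈⟨ inner-∏-imaginary c-im d-im ⟩
        product (λ l → im (c l) * im (d l))
          ≈⟨ product-cong (λ l → *-cong (im-⊝ (λs j) (λs (punchIn j l))) (im-⊝ (λs j) (μs l))) ⟩
        product (λ l → (im (λs j) - im (λs (punchIn j l))) * (im (λs j) - im (μs l))) ∎

  interlace-stable : ∀ {m} {a : Vector Carrier (suc m)} {b : Vector Carrier m} → ¬ ¬ Interlace a b → Interlace a b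
  interlace-stable ¬¬ab i =
    (λ x → ¬¬ab λ ab → proj₁ (ab i) x) , (λ x → ¬¬ab λ ab → proj₂ (ab i) x)

  halfPlane⇒interlace : ∀ {m} {λs : Vector ℂ (suc m)} {μs : Vector ℂ m} → Imaginary λs → Imaginary μs →
    Sorted (im ∘ λs) → Sorted (im ∘ μs) → HalfPlane λs μs → Interlace (im ∘ λs) (im ∘ μs)
  halfPlane⇒interlace {zero} λ-im μ-im λ↗ μ↗ half ()
  halfPlane⇒interlace {suc m} {λs} {μs} λ-im μ-im λ↗ μ↗ half = interlace-stable {a = im ∘ λs} {b = im ∘ μs} λ k →
    -- Whether a common zero exists is undecidable. Interlacing is a conjunction of negations, so
    -- the question may be settled under `¬¬`.
    ¬¬-excluded-middle {A = ∃[ i ] ∃[ j ] (λs i ≈ᶜ μs j)} λ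
      { (yes (i , j , λi≈μj)) →
          let inter = halfPlane⇒interlace (λ-im ∘ punchIn i) (μ-im ∘ punchIn j)
                (λ p → λ↗ (Fin.punchIn-mono-≤ i _ _ p)) (λ p → μ↗ (Fin.punchIn-mono-≤ j _ _ p))
                (halfPlane-cancel {λs = λs} {μs = μs} i j λi≈μj (μ-im j) half)
              open Insert {a = im ∘ λs} {b = im ∘ μs} λ↗ μ↗ i j (im-cong λi≈μj) inter
          in k (λ l → lower l , upper l)
      ; (no disjoint) →
          ¬¬-finite (λ i → Residue.residue-pos {λs = λs} {μs = μs} λ-im μ-im half i (λ j λi≈μj → disjoint (i , j , λi≈μj))) λ residue>0 →
          Gaps.interlace {a = im ∘ λs} {b = im ∘ μs} λ↗ μ↗
            (λ i j eq → disjoint (i , j , ext (trans (λ-im i) (sym (μ-im j))) eq)) residue>0 k }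

  -- Evaluated at `λs l` the product formula has a vanishing factor, so `λs l` is a zero of the
  -- characteristic polynomial.
  spectrum-imaginary : ∀ {n} {A : Matrix Carrier n} {λs : Vector ℂ n} → Skew A →
    (∀ z → charPoly A z ≈ᶜ monic λs z) → Imaginary λs
  spectrum-imaginary {A = A} {λs} skew spectrum l = root-imaginary {A = A} skew {λs l}
    (C.trans (spectrum (λs l)) (∏-zero l (C.-‿inverseʳ (λs l))))

  spectra-halfPlane : ∀ {m} {A : Matrix Carrier (suc m)} → Skew A → ∀ k {λs : Vector ℂ (suc m)} {μs : Vector ℂ m} →
    (∀ z → charPoly A z ≈ᶜ monic λs z) → (∀ z → charPoly (principalSubmatrix k A) z ≈ᶜ monic μs z) →
    HalfPlane λs μs
  spectra-halfPlane {A = A} skew k {λs} {μs} λ-spec μ-spec z re>0 =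
    let (r , r≥0 , qp≈) = inner-charPoly {A = A} skew k z in
    ≤-trans
      (nonNeg-resp (solve 3 (λ x n r → x :* r := x :* (n :+ r) :- x :* n) refl (re z) (N (monic μs z)) r)
        (*-nonNeg (pos⇒nonNeg re>0) r≥0))
      (≤-reflexive (trans (*-congˡ (+-congʳ (N-cong (C.sym (μ-spec z)))))
        (trans (sym qp≈) (trans (inner-cong (μ-spec z) (λ-spec z)) (inner-sym (monic μs z) (monic λs z))))))

  cauchy-interlacing : ∀ {m} {A : Matrix Carrier (suc m)} → Skew A → ∀ k {λs : Vector ℂ (suc m)} {μs : Vector ℂ m} →
    (∀ z → charPoly A z ≈ᶜ monic λs z) → (∀ z → charPoly (principalSubmatrix k A) z ≈ᶜ monic μs z) →
    Sorted (im ∘ λs) → Sorted (im ∘ μs) →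
    Imaginary λs × Imaginary μs × Interlace (im ∘ λs) (im ∘ μs)
  cauchy-interlacing {A = A} skew k {λs} {μs} λ-spec μ-spec λ↗ μ↗ =
    λ-im , μ-im , halfPlane⇒interlace λ-im μ-im λ↗ μ↗ (spectra-halfPlane {A = A} skew k {λs} {μs} λ-spec μ-spec)
    where
    λ-im : Imaginary λs
    λ-im = spectrum-imaginary {A = A} {λs} skew λ-spec
    μ-im : Imaginary μs
    μ-im = spectrum-imaginary {A = principalSubmatrix k A} {μs} (λ i j → skew (punchIn k i) (punchIn k j)) μ-spec

-- Cauchy sequences as an ordered ring

open import Defs hiding (det; identity; charPoly)
import Defs

module RationalLemmas where
  open ℚ.+-*-Solver
  open ℚ.≤-Reasoning

  ½-pos : ∀ {ε} → 0ℚ ℚ.< ε → 0ℚ ℚ.< ½ ℚ.* ε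
  ½-pos {ε} 0<ε = ℚ.positive⁻¹ (½ ℚ.* ε) {{ℚ.pos*pos⇒pos ½ ε {{ℚ.positive 0<ε}}}}

  ½+½ : ∀ ε → ½ ℚ.* ε ℚ.+ ½ ℚ.* ε ≡ ε
  ½+½ = solve 1 (λ ε → con ½ :* ε :+ con ½ :* ε := ε) ≡.refl

  ½< : ∀ {ε} → 0ℚ ℚ.< ε → ½ ℚ.* ε ℚ.< ε
  ½< {ε} 0<ε = begin-strict
    ½ ℚ.* ε               ≡⟨ ℚ.+-identityˡ _ ⟨
    0ℚ ℚ.+ ½ ℚ.* ε        <⟨ ℚ.+-monoˡ-< (½ ℚ.* ε) (½-pos 0<ε) ⟩
    ½ ℚ.* ε ℚ.+ ½ ℚ.* ε   ≡⟨ ½+½ ε ⟩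
    ε                     ∎

  ∣∣-bounds : ∀ {p ε} → p ℚ.< ε → ℚ.- p ℚ.< ε → ∣ p ∣ ℚ.< ε
  ∣∣-bounds {p} {ε} p<ε -p<ε with ℚ.∣p∣≡p∨∣p∣≡-p p
  ... | inj₁ eq = ≡.subst (ℚ._< ε) (≡.sym eq) p<ε
  ... | inj₂ eq = ≡.subst (ℚ._< ε) (≡.sym eq) -p<ε

  ≤∣∣ : ∀ p → p ℚ.≤ ∣ p ∣
  ≤∣∣ p with ℚ.≤-total 0ℚ p
  ... | inj₁ 0≤p = ℚ.≤-reflexive (≡.sym (ℚ.0≤p⇒∣p∣≡p 0≤p))
  ... | inj₂ p≤0 = ℚ.≤-trans p≤0 (ℚ.0≤∣p∣ p)

  ∣-∣-sym : ∀ p q → ∣ p ℚ.- q ∣ ≡ ∣ q ℚ.- p ∣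
  ∣-∣-sym p q = ≡.trans (≡.sym (ℚ.∣-p∣≡∣p∣ (p ℚ.- q)))
    (≡.cong ∣_∣ (solve 2 (λ p q → :- (p :- q) := q :- p) ≡.refl p q))

  ≥-nearby : ∀ {δ p q} → δ ℚ.+ δ ℚ.≤ p → ∣ p ℚ.- q ∣ ℚ.< δ → δ ℚ.≤ q
  ≥-nearby {δ} {p} {q} 2δ≤p p-q<δ = begin
    δ                        ≡⟨ solve 1 (λ δ → δ := (δ :+ δ) :+ :- δ) ≡.refl δ ⟩
    (δ ℚ.+ δ) ℚ.+ ℚ.- δ      ≤⟨ ℚ.+-mono-≤ 2δ≤p (ℚ.neg-antimono-≤ (ℚ.≤-trans (≤∣∣ (p ℚ.- q)) (ℚ.<⇒≤ p-q<δ))) ⟩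
    p ℚ.+ ℚ.- (p ℚ.- q)      ≡⟨ solve 2 (λ p q → p :+ :- (p :- q) := q) ≡.refl p q ⟩
    q                        ∎

  ∣+∣< : ∀ {p q δ ε} → ∣ p ∣ ℚ.< δ → ∣ q ∣ ℚ.< ε → ∣ p ℚ.+ q ∣ ℚ.< δ ℚ.+ ε
  ∣+∣< {p} {q} p<δ q<ε = ℚ.≤-<-trans (ℚ.∣p+q∣≤∣p∣+∣q∣ p q) (ℚ.+-mono-< p<δ q<ε)

  *-mono-nonNeg : ∀ {p q r s} → 0ℚ ℚ.≤ r → 0ℚ ℚ.≤ q → p ℚ.≤ q → r ℚ.≤ s → p ℚ.* r ℚ.≤ q ℚ.* s
  *-mono-nonNeg {p} {q} {r} {s} 0≤r 0≤q p≤q r≤s = ℚ.≤-trans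
    (ℚ.*-monoʳ-≤-nonNeg r {{ℚ.nonNegative 0≤r}} p≤q)
    (ℚ.*-monoˡ-≤-nonNeg q {{ℚ.nonNegative 0≤q}} r≤s)

  *-pos : ∀ {p q} → 0ℚ ℚ.< p → 0ℚ ℚ.< q → 0ℚ ℚ.< p ℚ.* q
  *-pos {p} {q} 0<p 0<q = ℚ.positive⁻¹ (p ℚ.* q) {{ℚ.pos*pos⇒pos p {{ℚ.positive 0<p}} q {{ℚ.positive 0<q}}}}

  quotient : ∀ B ε → 0ℚ ℚ.< B → 0ℚ ℚ.< ε → ∃[ δ ] (0ℚ ℚ.< δ × B ℚ.* δ ≡ ε)
  quotient B ε 0<B 0<ε = ε ℚ.* i , *-pos 0<ε (ℚ.positive⁻¹ i {{ℚ.1/pos⇒pos B {{B>0}}}}) ,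
    ≡.trans (solve 3 (λ B ε i → B :* (ε :* i) := ε :* (i :* B)) ≡.refl B ε i)
      (≡.trans (≡.cong (ε ℚ.*_) (ℚ.*-inverseˡ B {{B≢0}})) (ℚ.*-identityʳ ε))
    where
    B>0 = ℚ.positive 0<B
    B≢0 = ℚ.pos⇒nonZero B {{B>0}}
    i : ℚ
    i = (ℚ.1/ B) {{B≢0}}

Eventually : (ℕ → Set) → Set
Eventually P = ∃[ N ] (∀ n → N ℕ.≤ n → P n)

eventually-map : ∀ {P Q : ℕ → Set} → (∀ {n} → P n → Q n) → Eventually P → Eventually Q
eventually-map f (N , p) = N , λ n N≤n → f (p n N≤n)

eventually-map₂ : ∀ {P Q S : ℕ → Set} → (∀ {n} → P n → Q n → S n) → Eventually P → Eventually Q → Eventually S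
eventually-map₂ f (N , p) (M , q) = N ℕ.⊔ M , λ n le →
  f (p n (ℕ.m⊔n≤o⇒m≤o N M le)) (q n (ℕ.m⊔n≤o⇒n≤o N M le))

module RealNumbers where
  open ℝ
  open RationalLemmas
  open ℚ.+-*-Solver

  -- The ring laws hold termwise in ℚ and are inherited through this lemma; the congruences require
  -- estimates.
  ≈-pointwise : ∀ {x y} → (∀ n → seq x n ≡ seq y n) → x ≈ℝ y
  ≈-pointwise {x} {y} eq ε 0<ε = 0 , λ n _ → ≡.subst (ℚ._< ε)
    (≡.sym (≡.trans (≡.cong (λ p → ∣ p ℚ.- seq y n ∣) (eq n)) (≡.cong ∣_∣ (ℚ.+-inverseʳ (seq y n))))) 0<ε

  ≈-refl : ∀ {x} → x ≈ℝ x
  ≈-refl {x} = ≈-pointwise {x} {x} λ _ → ≡.refl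

  ≈-sym : ∀ {x y} → x ≈ℝ y → y ≈ℝ x
  ≈-sym {x} {y} x≈y ε 0<ε = eventually-map
    (λ {n} → ≡.subst (ℚ._< ε) (∣-∣-sym (seq x n) (seq y n))) (x≈y ε 0<ε)

  ≈-trans : ∀ {x y z} → x ≈ℝ y → y ≈ℝ z → x ≈ℝ z
  ≈-trans {x} {y} {z} x≈y y≈z ε 0<ε = eventually-map₂
    (λ {n} p q → ≡.subst₂ (λ u v → ∣ u ∣ ℚ.< v)
      (solve 3 (λ a b c → (a :- b) :+ (b :- c) := a :- c) ≡.refl (seq x n) (seq y n) (seq z n))
      (½+½ ε) (∣+∣< {seq x n ℚ.- seq y n} p q))
    (x≈y (½ ℚ.* ε) (½-pos 0<ε)) (y≈z (½ ℚ.* ε) (½-pos 0<ε))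

  +-cong : ∀ {x y u v} → x ≈ℝ y → u ≈ℝ v → x +ℝ u ≈ℝ y +ℝ v
  +-cong {x} {y} {u} {v} x≈y u≈v ε 0<ε = eventually-map₂
    (λ {n} p q → ≡.subst₂ (λ r s → ∣ r ∣ ℚ.< s)
      (solve 4 (λ a b c d → (a :- b) :+ (c :- d) := (a :+ c) :- (b :+ d)) ≡.refl
        (seq x n) (seq y n) (seq u n) (seq v n))
      (½+½ ε) (∣+∣< {seq x n ℚ.- seq y n} p q))
    (x≈y (½ ℚ.* ε) (½-pos 0<ε)) (u≈v (½ ℚ.* ε) (½-pos 0<ε))

  neg-cong : ∀ {x y} → x ≈ℝ y → -ℝ x ≈ℝ -ℝ y
  neg-cong {x} {y} x≈y ε 0<ε = eventually-map
    (λ {n} → ≡.subst (ℚ._< ε) (≡.trans (∣-∣-sym (seq x n) (seq y n)) (≡.cong ∣_∣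
      (solve 2 (λ a b → b :- a := (:- a) :- (:- b)) ≡.refl (seq x n) (seq y n))))) (x≈y ε 0<ε)

  bounded : ∀ x → ∃[ K ] (0ℚ ℚ.< K × Eventually (λ n → ∣ seq x n ∣ ℚ.≤ K))
  bounded x with N , close ← cauchy x 1ℚ (ℚ.positive⁻¹ 1ℚ) =
    1ℚ ℚ.+ ∣ seq x N ∣ , ℚ.+-mono-<-≤ (ℚ.positive⁻¹ 1ℚ) (ℚ.0≤∣p∣ (seq x N)) , N , λ n N≤n → begin
      ∣ seq x n ∣
        ≡⟨ ≡.cong ∣_∣ (solve 2 (λ a b → a := (a :- b) :+ b) ≡.refl (seq x n) (seq x N)) ⟩
      ∣ (seq x n ℚ.- seq x N) ℚ.+ seq x N ∣
        ≤⟨ ℚ.∣p+q∣≤∣p∣+∣q∣ (seq x n ℚ.- seq x N) (seq x N) ⟩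
      ∣ seq x n ℚ.- seq x N ∣ ℚ.+ ∣ seq x N ∣
        ≤⟨ ℚ.+-monoˡ-≤ ∣ seq x N ∣ (ℚ.<⇒≤ (close n N N≤n ℕ.≤-refl)) ⟩
      1ℚ ℚ.+ ∣ seq x N ∣ ∎
    where open ℚ.≤-Reasoning

  ∣*-*∣< : ∀ {K δ ε} a b c → 0ℚ ℚ.< K → 0ℚ ℚ.< ε → K ℚ.* δ ≡ ½ ℚ.* ε →
    ∣ a ∣ ℚ.≤ K → ∣ b ℚ.- c ∣ ℚ.< δ → ∣ a ℚ.* b ℚ.- a ℚ.* c ∣ ℚ.< ε
  ∣*-*∣< {K} {δ} {ε} a b c 0<K 0<ε Kδ≡½ε a≤K b-c<δ = begin-strict
    ∣ a ℚ.* b ℚ.- a ℚ.* c ∣   ≡⟨ ≡.cong ∣_∣ (solve 3 (λ a b c → a :* b :- a :* c := a :* (b :- c)) ≡.refl a b c) ⟩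
    ∣ a ℚ.* (b ℚ.- c) ∣       ≡⟨ ℚ.∣p*q∣≡∣p∣*∣q∣ a (b ℚ.- c) ⟩
    ∣ a ∣ ℚ.* ∣ b ℚ.- c ∣     ≤⟨ *-mono-nonNeg (ℚ.0≤∣p∣ (b ℚ.- c)) (ℚ.<⇒≤ 0<K) a≤K (ℚ.<⇒≤ b-c<δ) ⟩
    K ℚ.* δ                   ≡⟨ Kδ≡½ε ⟩
    ½ ℚ.* ε                   <⟨ ½< 0<ε ⟩
    ε                         ∎
    where open ℚ.≤-Reasoning

  *-congˡ : ∀ {x u v} → u ≈ℝ v → x *ℝ u ≈ℝ x *ℝ v
  *-congˡ {x} {u} {v} u≈v ε 0<ε =
    let K , 0<K , x≤K    = bounded x
        δ , 0<δ , Kδ≡½ε  = quotient K (½ ℚ.* ε) 0<K (½-pos 0<ε)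
    in eventually-map₂ (λ {n} → ∣*-*∣< (seq x n) (seq u n) (seq v n) 0<K 0<ε Kδ≡½ε) x≤K (u≈v δ 0<δ)

  *-comm : ∀ x y → x *ℝ y ≈ℝ y *ℝ x
  *-comm x y = ≈-pointwise {x *ℝ y} {y *ℝ x} λ n → ℚ.*-comm (seq x n) (seq y n)

  *-cong : ∀ {x y u v} → x ≈ℝ y → u ≈ℝ v → x *ℝ u ≈ℝ y *ℝ v
  *-cong {x} {y} {u} {v} x≈y u≈v =
    ≈-trans {x *ℝ u} {x *ℝ v} {y *ℝ v} (*-congˡ {x} {u} {v} u≈v)
      (≈-trans {x *ℝ v} {v *ℝ x} {y *ℝ v} (*-comm x v)
        (≈-trans {v *ℝ x} {v *ℝ y} {y *ℝ v} (*-congˡ {v} {x} {y} x≈y) (*-comm v y)))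

  isCommutativeRing : IsCommutativeRing _≈ℝ_ _+ℝ_ _*ℝ_ -ℝ_ 0ℝ 1ℝ
  isCommutativeRing = record
    { isRing = record
      { +-isAbelianGroup = record
        { isGroup = record
          { isMonoid = record
            { isSemigroup = record
              { isMagma = record
                { isEquivalence = record
                  { refl  = λ {x} → ≈-refl {x}
                  ; sym   = λ {x} {y} → ≈-sym {x} {y}
                  ; trans = λ {x} {y} {z} → ≈-trans {x} {y} {z} }
                ; ∙-cong = λ {x} {y} {u} {v} → +-cong {x} {y} {u} {v} }
              ; assoc = λ x y z → ≈-pointwise {x +ℝ y +ℝ z} {x +ℝ (y +ℝ z)} λ n →
                  ℚ.+-assoc (seq x n) (seq y n) (seq z n) }
            ; identity = (λ x → ≈-pointwise {0ℝ +ℝ x} {x} λ n → ℚ.+-identityˡ (seq x n))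
                       , (λ x → ≈-pointwise {x +ℝ 0ℝ} {x} λ n → ℚ.+-identityʳ (seq x n)) }
          ; inverse = (λ x → ≈-pointwise { -ℝ x +ℝ x} {0ℝ} λ n → ℚ.+-inverseˡ (seq x n))
                    , (λ x → ≈-pointwise {x +ℝ -ℝ x} {0ℝ} λ n → ℚ.+-inverseʳ (seq x n))
          ; ⁻¹-cong = λ {x} {y} → neg-cong {x} {y} }
        ; comm = λ x y → ≈-pointwise {x +ℝ y} {y +ℝ x} λ n → ℚ.+-comm (seq x n) (seq y n) }
      ; *-cong = λ {x} {y} {u} {v} → *-cong {x} {y} {u} {v}
      ; *-assoc = λ x y z → ≈-pointwise {x *ℝ y *ℝ z} {x *ℝ (y *ℝ z)} λ n →
          ℚ.*-assoc (seq x n) (seq y n) (seq z n)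
      ; *-identity = (λ x → ≈-pointwise {1ℝ *ℝ x} {x} λ n → ℚ.*-identityˡ (seq x n))
                   , (λ x → ≈-pointwise {x *ℝ 1ℝ} {x} λ n → ℚ.*-identityʳ (seq x n))
      ; distrib = (λ x y z → ≈-pointwise {x *ℝ (y +ℝ z)} {x *ℝ y +ℝ x *ℝ z} λ n →
                    ℚ.*-distribˡ-+ (seq x n) (seq y n) (seq z n))
                , (λ x y z → ≈-pointwise {(y +ℝ z) *ℝ x} {y *ℝ x +ℝ z *ℝ x} λ n →
                    ℚ.*-distribʳ-+ (seq x n) (seq y n) (seq z n)) }
    ; *-comm = *-comm }

  commutativeRing : CommutativeRing 0ℓ 0ℓ
  commutativeRing = record { isCommutativeRing = isCommutativeRing }

  -- The uniform margin makes positivity invariant under `_≈ℝ_`; termwise positivity is not, as the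
  -- sequence 1/(n + 1) represents zero.
  Pos : ℝ → Set
  Pos x = ∃[ ε ] (0ℚ ℚ.< ε × Eventually (λ n → ε ℚ.≤ seq x n))

  <-nearby : ∀ {ε p q} → 0ℚ ℚ.< ε → q ℚ.< ½ ℚ.* ε → ∣ p ℚ.- q ∣ ℚ.< ½ ℚ.* (½ ℚ.* ε) → p ℚ.< ε
  <-nearby {ε} {p} {q} 0<ε q<½ε p-q<¼ε = begin-strict
    p                         ≡⟨ solve 2 (λ a b → a := (a :- b) :+ b) ≡.refl p q ⟩
    (p ℚ.- q) ℚ.+ q           <⟨ ℚ.+-mono-< (ℚ.≤-<-trans (≤∣∣ (p ℚ.- q)) (ℚ.<-trans p-q<¼ε (½< (½-pos 0<ε)))) q<½ε ⟩
    ½ ℚ.* ε ℚ.+ ½ ℚ.* ε       ≡⟨ ½+½ ε ⟩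
    ε                         ∎
    where open ℚ.≤-Reasoning

  -- One rational comparison decides: beyond N all terms lie within ε/4 of the N-th. If that term is
  -- below ε/2, all later ones are below ε; if not, they stay above ε/4 and `x` is positive.
  ¬pos⇒< : ∀ x → ¬ Pos x → ∀ ε → 0ℚ ℚ.< ε → Eventually (λ n → seq x n ℚ.< ε)
  ¬pos⇒< x ¬x>0 ε 0<ε =
    let N , close = cauchy x (½ ℚ.* (½ ℚ.* ε)) (½-pos (½-pos 0<ε))
    in compare N close (seq x N ℚ.<? ½ ℚ.* ε)
    where
    compare : ∀ N → (∀ m n → N ℕ.≤ m → N ℕ.≤ n → ∣ seq x m ℚ.- seq x n ∣ ℚ.< ½ ℚ.* (½ ℚ.* ε)) →
      Dec (seq x N ℚ.< ½ ℚ.* ε) → Eventually (λ n → seq x n ℚ.< ε)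
    compare N close (yes xN<½ε) = N , λ n N≤n → <-nearby 0<ε xN<½ε (close n N N≤n ℕ.≤-refl)
    compare N close (no xN≮½ε) = contradiction
      (½ ℚ.* (½ ℚ.* ε) , ½-pos (½-pos 0<ε) , N , λ n N≤n → ≥-nearby
        (ℚ.≤-trans (ℚ.≤-reflexive (½+½ (½ ℚ.* ε))) (ℚ.≮⇒≥ xN≮½ε)) (close N n ℕ.≤-refl N≤n))
      ¬x>0

  small<1 : ∀ {B ε s} → 0ℚ ℚ.< B → 0ℚ ℚ.< ε → (B ℚ.+ ε) ℚ.* s ≡ ½ ℚ.* ε → 0ℚ ℚ.< 1ℚ ℚ.- s
  small<1 {B} {ε} {s} 0<B 0<ε Ds≡½ε = ≡.subst (ℚ._< 1ℚ ℚ.- s) (ℚ.+-inverseʳ s) (ℚ.+-monoˡ-< (ℚ.- s) s<1)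
    where
    open ℚ.≤-Reasoning
    s<1 : s ℚ.< 1ℚ
    s<1 = ℚ.≰⇒> λ 1≤s → ℚ.<-irrefl ≡.refl (begin-strict
      ½ ℚ.* ε              <⟨ ½< 0<ε ⟩
      ε                    ≡⟨ ℚ.*-identityʳ ε ⟨
      ε ℚ.* 1ℚ             ≤⟨ *-mono-nonNeg (ℚ.<⇒≤ (ℚ.positive⁻¹ 1ℚ)) (ℚ.<⇒≤ (ℚ.+-mono-< 0<B 0<ε))
                                (ℚ.≤-trans (ℚ.≤-reflexive (≡.sym (ℚ.+-identityˡ ε))) (ℚ.+-monoˡ-≤ ε (ℚ.<⇒≤ 0<B))) 1≤s ⟩
      (B ℚ.+ ε) ℚ.* s      ≡⟨ Ds≡½ε ⟩
      ½ ℚ.* ε              ∎)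

  difference-≥ : ∀ {B ε s c K} → 0ℚ ℚ.< s → 0ℚ ℚ.< ε → (B ℚ.+ ε) ℚ.* s ≡ ½ ℚ.* ε →
    ε ℚ.≤ c → ∣ K ∣ ℚ.≤ B → ½ ℚ.* ε ℚ.≤ c ℚ.- s ℚ.* K
  difference-≥ {B} {ε} {s} {c} {K} 0<s 0<ε Ds≡½ε c≥ε K≤B = begin
    ½ ℚ.* ε             ≡⟨ solve 1 (λ ε → con ½ :* ε := ε :- con ½ :* ε) ≡.refl ε ⟩
    ε ℚ.- ½ ℚ.* ε       ≤⟨ ℚ.+-mono-≤ c≥ε (ℚ.neg-antimono-≤ sK≤½ε) ⟩
    c ℚ.- s ℚ.* K       ∎
    where
    open ℚ.≤-Reasoning
    s≥0 = ℚ.nonNegative (ℚ.<⇒≤ 0<s)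
    sK≤½ε : s ℚ.* K ℚ.≤ ½ ℚ.* ε
    sK≤½ε = begin
      s ℚ.* K             ≤⟨ ℚ.*-monoˡ-≤-nonNeg s {{s≥0}} (ℚ.≤-trans (≤∣∣ K) K≤B) ⟩
      s ℚ.* B             ≡⟨ ℚ.*-comm s B ⟩
      B ℚ.* s             ≤⟨ ℚ.*-monoʳ-≤-nonNeg s {{s≥0}}
                               (ℚ.≤-trans (ℚ.≤-reflexive (≡.sym (ℚ.+-identityʳ B))) (ℚ.+-monoʳ-≤ B (ℚ.<⇒≤ 0<ε))) ⟩
      (B ℚ.+ ε) ℚ.* s     ≡⟨ Ds≡½ε ⟩
      ½ ℚ.* ε             ∎

  positiveCone : PositiveCone commutativeRing
  positiveCone = record
    { Pos      = Pos
    ; pos-resp = λ {x} {y} x≈y (ε , 0<ε , x≥ε) → ½ ℚ.* ε , ½-pos 0<ε , eventually-map₂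
        (λ xn≥ε → ≥-nearby (ℚ.≤-trans (ℚ.≤-reflexive (½+½ ε)) xn≥ε)) x≥ε (x≈y (½ ℚ.* ε) (½-pos 0<ε))
    ; pos-1    = 1ℚ , ℚ.positive⁻¹ 1ℚ , 0 , λ _ _ → ℚ.≤-refl
    ; +-pos    = λ (ε , 0<ε , x≥ε) (δ , 0<δ , y≥δ) → ε ℚ.+ δ , ℚ.+-mono-< 0<ε 0<δ , eventually-map₂ ℚ.+-mono-≤ x≥ε y≥δ
    ; *-pos    = λ (ε , 0<ε , x≥ε) (δ , 0<δ , y≥δ) → ε ℚ.* δ , *-pos 0<ε 0<δ , eventually-map₂
        (λ xn≥ε yn≥δ → *-mono-nonNeg (ℚ.<⇒≤ 0<δ) (ℚ.≤-trans (ℚ.<⇒≤ 0<ε) xn≥ε) xn≥ε yn≥δ) x≥ε y≥δ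
    ; ¬pos-0   = λ (ε , 0<ε , N , 0≥ε) → ℚ.<-irrefl ≡.refl (ℚ.<-≤-trans 0<ε (0≥ε N ℕ.≤-refl))
    ; tight    = λ {x} ¬x>0 ¬x<0 ε 0<ε → eventually-map₂
        (λ {n} x<ε -x<ε → ≡.subst (λ p → ∣ p ∣ ℚ.< ε)
          (solve 1 (λ a → a := a :- con 0ℚ) ≡.refl (seq x n)) (∣∣-bounds x<ε -x<ε))
        (¬pos⇒< x ¬x>0 ε 0<ε) (¬pos⇒< (-ℝ x) ¬x<0 ε 0<ε)
    ; small    = small }
    where
    small : ∀ K {c} → Pos c → ∃[ s ] (Pos s × Pos (1ℝ +ℝ -ℝ s) × Pos (c +ℝ -ℝ (s *ℝ K)))
    small K {c} (ε , 0<ε , c≥ε) =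
      let B , 0<B , K≤B      = bounded K
          -- Here s = (ε/2) / (B + ε). Since s B ≤ ε/2, the difference c - s K keeps the margin ε/2;
          -- the summand ε in the denominator keeps s below 1.
          s , 0<s , Ds≡½ε    = quotient (B ℚ.+ ε) (½ ℚ.* ε) (ℚ.+-mono-< 0<B 0<ε) (½-pos 0<ε)
      in fromℚ s , (s , 0<s , 0 , λ _ _ → ℚ.≤-refl) ,
         (1ℚ ℚ.- s , small<1 0<B 0<ε Ds≡½ε , 0 , λ _ _ → ℚ.≤-refl) ,
         (½ ℚ.* ε , ½-pos 0<ε , eventually-map₂ (difference-≥ 0<s 0<ε Ds≡½ε) c≥ε K≤B)

  open Order positiveCone using (_≤_)

  ≤⇒≤ℝ : ∀ {x y} → x ≤ y → x ≤ℝ y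
  ≤⇒≤ℝ {x} {y} x≤y ε 0<ε = eventually-map
    (λ {n} lt → ≡.subst₂ ℚ._<_ (solve 2 (λ a b → :- (b :- a) :+ b := a) ≡.refl (seq x n) (seq y n)) (ℚ.+-comm ε (seq y n))
      (ℚ.+-monoˡ-< (seq y n) lt))
    (¬pos⇒< (-ℝ (y +ℝ -ℝ x)) x≤y ε 0<ε)

  gap-absurd : ∀ {p q ε} → p ℚ.< q ℚ.+ ε → ¬ (ε ℚ.≤ ℚ.- (q ℚ.- p))
  gap-absurd {p} {q} {ε} p<q+ε ε≤p-q = ℚ.<-irrefl ≡.refl (begin-strict
    p                           <⟨ p<q+ε ⟩
    q ℚ.+ ε                     ≤⟨ ℚ.+-monoʳ-≤ q ε≤p-q ⟩
    q ℚ.+ ℚ.- (q ℚ.- p)         ≡⟨ solve 2 (λ a b → b :+ :- (b :- a) := a) ≡.refl p q ⟩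
    p                           ∎)
    where open ℚ.≤-Reasoning

  ≤ℝ⇒≤ : ∀ {x y} → x ≤ℝ y → x ≤ y
  ≤ℝ⇒≤ {x} {y} x≤y (ε , 0<ε , gap) =
    let N , absurd = eventually-map₂ (λ {n} → gap-absurd {seq x n} {seq y n}) (x≤y ε 0<ε) gap
    in absurd N ℕ.≤-refl

-- Pairs of Cauchy reals as a complex structure

module ComplexNumbers where
  open ℝ
  open ℂ
  open RealNumbers
  open ℚ.+-*-Solver

  ≈ℂ-pointwise : ∀ {z w} → (∀ n → seq (re z) n ≡ seq (re w) n) → (∀ n → seq (im z) n ≡ seq (im w) n) → z ≈ℂ w
  ≈ℂ-pointwise {z} {w} re≡ im≡ = ≈-pointwise {re z} {re w} re≡ , ≈-pointwise {im z} {im w} im≡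

  *ℂ-cong : ∀ {x y u v} → x ≈ℂ y → u ≈ℂ v → x *ℂ u ≈ℂ y *ℂ v
  *ℂ-cong {x} {y} {u} {v} (re-xy , im-xy) (re-uv , im-uv) =
    +-cong {re x *ℝ re u} {re y *ℝ re v} { -ℝ (im x *ℝ im u)} { -ℝ (im y *ℝ im v)}
      (*-cong {re x} {re y} {re u} {re v} re-xy re-uv)
      (neg-cong {im x *ℝ im u} {im y *ℝ im v} (*-cong {im x} {im y} {im u} {im v} im-xy im-uv)) ,
    +-cong {re x *ℝ im u} {re y *ℝ im v} {im x *ℝ re u} {im y *ℝ re v}
      (*-cong {re x} {re y} {im u} {im v} re-xy im-uv)
      (*-cong {im x} {im y} {re u} {re v} im-xy re-uv)

  *ℂ-assoc : ∀ x y z → x *ℂ y *ℂ z ≈ℂ x *ℂ (y *ℂ z)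
  *ℂ-assoc x y z = ≈ℂ-pointwise {x *ℂ y *ℂ z} {x *ℂ (y *ℂ z)}
    (λ n → solve 6 (λ a b c d e f →
      (a :* c :+ :- (b :* d)) :* e :+ :- ((a :* d :+ b :* c) :* f) :=
      a :* (c :* e :+ :- (d :* f)) :+ :- (b :* (c :* f :+ d :* e))) ≡.refl
      (seq (re x) n) (seq (im x) n) (seq (re y) n) (seq (im y) n) (seq (re z) n) (seq (im z) n))
    (λ n → solve 6 (λ a b c d e f →
      (a :* c :+ :- (b :* d)) :* f :+ (a :* d :+ b :* c) :* e :=
      a :* (c :* f :+ d :* e) :+ b :* (c :* e :+ :- (d :* f))) ≡.refl
      (seq (re x) n) (seq (im x) n) (seq (re y) n) (seq (im y) n) (seq (re z) n) (seq (im z) n))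

  *ℂ-comm : ∀ x y → x *ℂ y ≈ℂ y *ℂ x
  *ℂ-comm x y = ≈ℂ-pointwise {x *ℂ y} {y *ℂ x}
    (λ n → solve 4 (λ a b c d → a :* c :+ :- (b :* d) := c :* a :+ :- (d :* b)) ≡.refl
      (seq (re x) n) (seq (im x) n) (seq (re y) n) (seq (im y) n))
    (λ n → solve 4 (λ a b c d → a :* d :+ b :* c := c :* b :+ d :* a) ≡.refl
      (seq (re x) n) (seq (im x) n) (seq (re y) n) (seq (im y) n))

  *ℂ-identityˡ : ∀ x → 1ℂ *ℂ x ≈ℂ x
  *ℂ-identityˡ x = ≈ℂ-pointwise {1ℂ *ℂ x} {x}
    (λ n → solve 2 (λ a b → con 1ℚ :* a :+ :- (con 0ℚ :* b) := a) ≡.refl (seq (re x) n) (seq (im x) n))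
    (λ n → solve 2 (λ a b → con 1ℚ :* b :+ con 0ℚ :* a := b) ≡.refl (seq (re x) n) (seq (im x) n))

  *ℂ-distribˡ : ∀ x y z → x *ℂ (y +ℂ z) ≈ℂ x *ℂ y +ℂ x *ℂ z
  *ℂ-distribˡ x y z = ≈ℂ-pointwise {x *ℂ (y +ℂ z)} {x *ℂ y +ℂ x *ℂ z}
    (λ n → solve 6 (λ a b c d e f →
      a :* (c :+ e) :+ :- (b :* (d :+ f)) := (a :* c :+ :- (b :* d)) :+ (a :* e :+ :- (b :* f))) ≡.refl
      (seq (re x) n) (seq (im x) n) (seq (re y) n) (seq (im y) n) (seq (re z) n) (seq (im z) n))
    (λ n → solve 6 (λ a b c d e f →
      a :* (d :+ f) :+ b :* (c :+ e) := (a :* d :+ b :* c) :+ (a :* f :+ b :* e)) ≡.refl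
      (seq (re x) n) (seq (im x) n) (seq (re y) n) (seq (im y) n) (seq (re z) n) (seq (im z) n))

  ≈ℂ-trans : ∀ {x y z} → x ≈ℂ y → y ≈ℂ z → x ≈ℂ z
  ≈ℂ-trans {x} {y} {z} (re-xy , im-xy) (re-yz , im-yz) =
    ≈-trans {re x} {re y} {re z} re-xy re-yz , ≈-trans {im x} {im y} {im z} im-xy im-yz

  +ℂ-cong : ∀ {x y u v} → x ≈ℂ y → u ≈ℂ v → x +ℂ u ≈ℂ y +ℂ v
  +ℂ-cong {x} {y} {u} {v} (re-xy , im-xy) (re-uv , im-uv) =
    +-cong {re x} {re y} {re u} {re v} re-xy re-uv , +-cong {im x} {im y} {im u} {im v} im-xy im-uv

  private module R = CommutativeRing commutativeRing

  isCommutativeRingℂ : IsCommutativeRing _≈ℂ_ _+ℂ_ _*ℂ_ -ℂ_ 0ℂ 1ℂ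
  isCommutativeRingℂ = record
    { isRing = record
      { +-isAbelianGroup = record
        { isGroup = record
          { isMonoid = record
            { isSemigroup = record
              { isMagma = record
                { isEquivalence = record
                  { refl  = λ {x} → ≈-refl {re x} , ≈-refl {im x}
                  ; sym   = λ {x} {y} (re-xy , im-xy) → ≈-sym {re x} {re y} re-xy , ≈-sym {im x} {im y} im-xy
                  ; trans = λ {x} {y} {z} → ≈ℂ-trans {x} {y} {z} }
                ; ∙-cong = λ {x} {y} {u} {v} → +ℂ-cong {x} {y} {u} {v} }
              ; assoc = λ x y z → R.+-assoc (re x) (re y) (re z) , R.+-assoc (im x) (im y) (im z) }
            ; identity = (λ x → R.+-identityˡ (re x) , R.+-identityˡ (im x))
                       , (λ x → R.+-identityʳ (re x) , R.+-identityʳ (im x)) }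
          ; inverse = (λ x → R.-‿inverseˡ (re x) , R.-‿inverseˡ (im x))
                    , (λ x → R.-‿inverseʳ (re x) , R.-‿inverseʳ (im x))
          ; ⁻¹-cong = λ {x} {y} (re-xy , im-xy) → neg-cong {re x} {re y} re-xy , neg-cong {im x} {im y} im-xy }
        ; comm = λ x y → R.+-comm (re x) (re y) , R.+-comm (im x) (im y) }
      ; *-cong = λ {x} {y} {u} {v} → *ℂ-cong {x} {y} {u} {v}
      ; *-assoc = *ℂ-assoc
      ; *-identity = *ℂ-identityˡ
                   , (λ x → ≈ℂ-trans {x *ℂ 1ℂ} {1ℂ *ℂ x} {x} (*ℂ-comm x 1ℂ) (*ℂ-identityˡ x))
      ; distrib = *ℂ-distribˡ
                , (λ x y z → ≈ℂ-trans {(y +ℂ z) *ℂ x} {x *ℂ (y +ℂ z)} {y *ℂ x +ℂ z *ℂ x} (*ℂ-comm (y +ℂ z) x)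
                    (≈ℂ-trans {x *ℂ (y +ℂ z)} {x *ℂ y +ℂ x *ℂ z} {y *ℂ x +ℂ z *ℂ x} (*ℂ-distribˡ x y z)
                      (+ℂ-cong {x *ℂ y} {y *ℂ x} {x *ℂ z} {z *ℂ x} (*ℂ-comm x y) (*ℂ-comm x z)))) }
    ; *-comm = *ℂ-comm }

  commutativeRingℂ : CommutativeRing 0ℓ 0ℓ
  commutativeRingℂ = record { isCommutativeRing = isCommutativeRingℂ }

  complexStructure : ComplexStructure commutativeRing
  complexStructure = record
    { C       = commutativeRingℂ
    ; re      = re
    ; im      = im
    ; _+i_    = _+i_
    ; re-cong = _≈ℂ_.re-≈
    ; im-cong = _≈ℂ_.im-≈
    ; ext     = _,_
    ; re-+i   = λ x y → ≈-refl {x}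
    ; im-+i   = λ x y → ≈-refl {y}
    ; re-⊕    = λ z w → ≈-refl {re z +ℝ re w}
    ; im-⊕    = λ z w → ≈-refl {im z +ℝ im w}
    ; re-⊖    = λ z → ≈-refl { -ℝ re z}
    ; im-⊖    = λ z → ≈-refl { -ℝ im z}
    ; re-⊗    = λ z w → ≈-refl {re (z *ℂ w)}
    ; im-⊗    = λ z w → ≈-refl {im (z *ℂ w)}
    ; re-0    = ≈-refl {0ℝ}
    ; im-0    = ≈-refl {0ℝ}
    ; re-1    = ≈-refl {1ℝ}
    ; im-1    = ≈-refl {0ℝ} }

-- Transfer to the notions of the theorem

module FromDefs where
  open ℝ
  open ℂ
  open RealNumbers
  open ComplexNumbers
  open ℚ.+-*-Solver
  open Order positiveCone using (_≤_; ≤-trans; ≤-reflexive)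
  open CharacteristicPolynomial positiveCone complexStructure using (identity; charMatrix; charPoly)
  open Determinants commutativeRingℂ using (det)
  private module C = CommutativeRing commutativeRingℂ
  open SemiringSum C.semiring using (sum-cong-≋)
  open Exp C.semiring using (_^_)

  det-agrees : ∀ {n} (M N : Matrix ℂ n) → (∀ i j → M i j ≡ N i j) → Defs.det M ≈ℂ det N
  det-agrees {zero}  M N M≡N = C.refl {1ℂ}
  det-agrees {suc n} M N M≡N = sum-cong-≋ {suc n}
    {λ j → (-ℂ 1ℂ) ^ toℕ j *ℂ M zero j *ℂ Defs.det (deleteRowCol zero j M)}
    {λ j → (-ℂ 1ℂ) ^ toℕ j *ℂ N zero j *ℂ det (deleteRowCol zero j N)}
    λ j → *ℂ-cong {(-ℂ 1ℂ) ^ toℕ j *ℂ M zero j} {(-ℂ 1ℂ) ^ toℕ j *ℂ N zero j}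
      (C.reflexive (≡.cong ((-ℂ 1ℂ) ^ toℕ j *ℂ_) (M≡N zero j)))
      (det-agrees (deleteRowCol zero j M) (deleteRowCol zero j N) (λ a b → M≡N (suc a) (punchIn j b)))

  identity-agrees : ∀ {n} (i j : Fin n) → Defs.identity i j ≡ identity i j
  identity-agrees zero    zero    = ≡.refl
  identity-agrees zero    (suc j) = ≡.refl
  identity-agrees (suc i) zero    = ≡.refl
  identity-agrees (suc i) (suc j) = identity-agrees i j

  charPoly-agrees : ∀ {n} (A : Matrix ℝ n) z → Defs.charPoly A z ≈ℂ charPoly A z
  charPoly-agrees A z = det-agrees _ (charMatrix A z) λ i j → ≡.cong (λ δ → z *ℂ δ -ℂ fromℝ (A i j)) (identity-agrees i j)

  -- Since (-i)(a + b i) = b - a i, the order of the theorem is the order of imaginary parts.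
  re-rotate : ∀ z → re (-ℂ 𝕚 *ℂ z) ≈ℝ im z
  re-rotate z = ≈-pointwise {re (-ℂ 𝕚 *ℂ z)} {im z} λ n →
    solve 2 (λ a b → (:- con 0ℚ) :* a :+ :- ((:- con 1ℚ) :* b) := b) ≡.refl (seq (re z) n) (seq (im z) n)

  ≤⇒≤ⁱ : ∀ {z w} → im z ≤ im w → z ≤ⁱ w
  ≤⇒≤ⁱ {z} {w} z≤w = ≤⇒≤ℝ {re (-ℂ 𝕚 *ℂ z)} {re (-ℂ 𝕚 *ℂ w)}
    (≤-trans {re (-ℂ 𝕚 *ℂ z)} {im z} {re (-ℂ 𝕚 *ℂ w)} (≤-reflexive {re (-ℂ 𝕚 *ℂ z)} {im z} (re-rotate z))
      (≤-trans {im z} {im w} {re (-ℂ 𝕚 *ℂ w)} z≤w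
        (≤-reflexive {im w} {re (-ℂ 𝕚 *ℂ w)} (≈-sym {re (-ℂ 𝕚 *ℂ w)} {im w} (re-rotate w)))))

  ≤ⁱ⇒≤ : ∀ {z w} → z ≤ⁱ w → im z ≤ im w
  ≤ⁱ⇒≤ {z} {w} z≤w = ≤-trans {im z} {re (-ℂ 𝕚 *ℂ z)} {im w}
    (≤-reflexive {im z} {re (-ℂ 𝕚 *ℂ z)} (≈-sym {re (-ℂ 𝕚 *ℂ z)} {im z} (re-rotate z)))
    (≤-trans {re (-ℂ 𝕚 *ℂ z)} {re (-ℂ 𝕚 *ℂ w)} {im w} (≤ℝ⇒≤ {re (-ℂ 𝕚 *ℂ z)} {re (-ℂ 𝕚 *ℂ w)} z≤w)
      (≤-reflexive {re (-ℂ 𝕚 *ℂ w)} {im w} (re-rotate w)))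

  re≈0⇒∈iℝ : ∀ {z} → re z ≈ℝ 0ℝ → z ∈iℝ
  re≈0⇒∈iℝ {z} re≈0 = im z ,
    (≈-trans {re z} {0ℝ} {re (𝕚 *ℂ fromℝ (im z))} re≈0 (≈-pointwise {0ℝ} {re (𝕚 *ℂ fromℝ (im z))} λ n →
      solve 1 (λ b → con 0ℚ := con 0ℚ :* b :+ :- (con 1ℚ :* con 0ℚ)) ≡.refl (seq (im z) n)) ,
     ≈-pointwise {im z} {im (𝕚 *ℂ fromℝ (im z))} λ n →
      solve 1 (λ b → b := con 0ℚ :* con 0ℚ :+ con 1ℚ :* b) ≡.refl (seq (im z) n))

theorem1p1 : ∀ (m : ℕ) (A : Matrix ℝ (suc m)) → SkewSymmetric A →
    (k : Fin (suc m)) (λs : Vector ℂ (suc m)) (μs : Vector ℂ m) →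
    IsSpectrum A λs → IsSpectrum (principalSubmatrix k A) μs →
    Interlaces μs λs
theorem1p1 m A skew k λs μs λ-spec μ-spec = record
  { μs⊆iℝ         = λ i → re≈0⇒∈iℝ {μs i} (proj₁ (proj₂ interlacing) i)
  ; λs⊆iℝ         = λ i → re≈0⇒∈iℝ {λs i} (proj₁ interlacing i)
  ; μs-increasing = increasing μ-spec
  ; λs-increasing = increasing λ-spec
  ; lower         = λ i → ≤⇒≤ⁱ {λs (inject₁ i)} {μs i} (proj₁ (proj₂ (proj₂ interlacing) i))
  ; upper         = λ i → ≤⇒≤ⁱ {μs i} {λs (suc i)} (proj₂ (proj₂ (proj₂ interlacing) i)) }
  where
  open FromDefs
  open IsSpectrum
  open ComplexNumbers
  spectrum : ∀ {n} (B : Matrix ℝ n) {zs : Vector ℂ n} → IsSpectrum B zs →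
    ∀ z → CharacteristicPolynomial.charPoly RealNumbers.positiveCone complexStructure B z ≈ℂ
          Spectra.monic RealNumbers.positiveCone complexStructure zs z
  spectrum B spec z = ≈ℂ-trans (CommutativeRing.sym commutativeRingℂ (charPoly-agrees B z)) (eigenvalues spec z)
  interlacing = Spectra.cauchy-interlacing RealNumbers.positiveCone complexStructure {A = A} skew k {λs} {μs}
    (spectrum A λ-spec) (spectrum (principalSubmatrix k A) μ-spec)
    (λ {i} {j} i≤j → ≤ⁱ⇒≤ {λs i} {λs j} (increasing λ-spec i≤j))
    (λ {i} {j} i≤j → ≤ⁱ⇒≤ {μs i} {μs j} (increasing μ-spec i≤j))
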